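{- Let $d\ge 0$ be an integer, let $G$ be any finite $d$-regular graph and let $\lambda>0$. Then \[ \alpha_G(\lambda) \le \alpha_{K_{d+1}}(\lambda), \] with equality if and only if $G$ is a disjoint union of copies of $K_{d+1}$.
   Context: Graphs are finite, simple and have at least one vertex. A Widom--Rowlinson configuration on a graph $G$ is a map $\chi:V(G)\to\{0,1,2\}$ such that no vertex coloured $1$ is adjacent to a vertex coloured $2$. Let $\Omega(G)$ be the set of such configurations and $X_i(\chi)$ the number of vertices coloured $i$. The Widom--Rowlinson model on $G$ with activity $\lambda>0$ is the probability distribution on $\Omega(G)$ given by $\mathbb{P}[\chi]=\lambda^{X_1(\chi)+X_2(\chi)}/P_G(\lambda)$, where $P_G(\lambda)=\sum_{\chi\in\Omega(G)}\lambda^{X_1(\chi)+X_2(\chi)}$ is the partition function. The occupancy fraction is $\alpha_G(\lambda)=\mathbb{E}[X_1+X_2]/|V(G)|$, the expectation being over $\chi$ drawn from this model. $K_{d+1}$ denotes the complete graph on $d+1$ vertices. -}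

module Defs where

open import Algebra.Apartness.Bundles using (HeytingField; HeytingCommutativeRing)
import Algebra.Apartness.Properties.HeytingCommutativeRing as HeytingProperties
open import Algebra.Bundles using (CommutativeRing; Semiring)
import Algebra.Definitions.RawSemiring as RawSemiringDefinitions
import Algebra.Properties.Ring as RingProperties
open import Data.Fin using (Fin; _≟_)
open import Data.Fin.Patterns using (0F; 1F; 2F)
open import Data.Fin.Properties using (all?)
open import Data.List using (List; []; _∷_; map; foldr; filter; cartesianProductWith)
import Data.List as List
open import Data.List.Membership.Propositional using (_∈_)
open import Data.List.Membership.Propositional.Properties
  using (∈-allFin; ∈-cartesianProductWith⁺; ∈-filter⁺)
open import Data.List.Relation.Unary.Any using (here)
open import Data.Nat as ℕ using (ℕ; zero; suc; NonZero)
open import Data.Product using (_×_; _,_; proj₁; proj₂)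
open import Data.Sum using (_⊎_; inj₁; inj₂)
open import Data.Vec using (Vec; []; _∷_; allFin; count; lookup; replicate)
open import Data.Vec.Properties using (lookup-replicate)
open import Function.Bundles using (_↔_; _⇔_; Inverse)
open import Level using (0ℓ; _⊔_) renaming (suc to lsuc)
open import Relation.Binary.Core using (Rel)
open import Relation.Binary.Definitions using (Decidable; Irreflexive; Symmetric)
open import Relation.Binary.PropositionalEquality as ≡ using (_≡_; _≢_)
open import Relation.Binary.Structures using (IsStrictPartialOrder)
open import Relation.Nullary using (¬_; Dec; ¬?; _×-dec_; _→-dec_)

-- Ordered fields stand in for the real numbers.  Neither trichotomy nor
-- decidability of the order is assumed, so that the constructive reals are an
-- instance as well as the classical ones; cotransitivity of _<_ follows from
-- that of _#_.  As is usual in this setting, x ≤ y means ¬ (y < x).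

record OrderedField c ℓ₁ ℓ₂ ℓ₃ : Set (lsuc (c ⊔ ℓ₁ ⊔ ℓ₂ ⊔ ℓ₃)) where
  infix 4 _<_ _≤_
  field
    heytingField : HeytingField c ℓ₁ ℓ₂
  open HeytingField heytingField public
  field
    _<_                  : Rel Carrier ℓ₃
    isStrictPartialOrder : IsStrictPartialOrder _≈_ _<_
    #⇒<⊎>                : ∀ {x y} → x # y → x < y ⊎ y < x
    <⇒#                  : ∀ {x y} → x < y → x # y
    +-monoˡ-<            : ∀ z {x y} → x < y → x + z < y + z
    *-pos                : ∀ {x y} → 0# < x → 0# < y → 0# < x * y

  open IsStrictPartialOrder isStrictPartialOrder public
    using (<-respˡ-≈; <-respʳ-≈)
    renaming (irrefl to <-irrefl; trans to <-trans; asym to <-asym)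

  commutativeRing : CommutativeRing c ℓ₁
  commutativeRing = HeytingCommutativeRing.commutativeRing heytingCommutativeRing

  open HeytingProperties heytingCommutativeRing using (1#0; x-0≈x)
  open CommutativeRing commutativeRing using (ring; semiring)
  open RingProperties ring using (-1*x≈-x; -‿involutive)
  open RawSemiringDefinitions (Semiring.rawSemiring semiring) public
    using (_^_)
    renaming (_×_ to _·_)

  _≤_ : Rel Carrier ℓ₃
  x ≤ y = ¬ (y < x)

  0<1 : 0# < 1#
  0<1 with #⇒<⊎> 1#0
  ... | inj₂ 0<1 = 0<1
  ... | inj₁ 1<0 = <-respʳ-≈ -1*-1≈1 (*-pos 0<-1 0<-1)
    where
    0<-1 : 0# < - 1#
    0<-1 = <-respˡ-≈ (-‿inverseʳ 1#)
             (<-respʳ-≈ (+-identityˡ (- 1#)) (+-monoˡ-< (- 1#) 1<0))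
    -1*-1≈1 : - 1# * - 1# ≈ 1#
    -1*-1≈1 = trans (-1*x≈-x (- 1#)) (-‿involutive 1#)

  +-pos : ∀ {x y} → 0# < x → 0# < y → 0# < x + y
  +-pos {x} {y} 0<x 0<y =
    <-trans 0<y (<-respˡ-≈ (+-identityˡ y) (+-monoˡ-< y 0<x))

  ^-pos : ∀ {x} n → 0# < x → 0# < x ^ n
  ^-pos zero    0<x = 0<1
  ^-pos (suc n) 0<x = *-pos 0<x (^-pos n 0<x)

  fromℕ : ℕ → Carrier
  fromℕ n = n · 1#

  fromℕ-pos : ∀ n .{{_ : NonZero n}} → 0# < fromℕ n
  fromℕ-pos (suc zero)    = <-respʳ-≈ (sym (+-identityʳ 1#)) 0<1
  fromℕ-pos (suc (suc n)) = +-pos 0<1 (fromℕ-pos (suc n))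

  recip : ∀ x → 0# < x → Carrier
  recip x 0<x = proj₁ (#⇒invertible (#-sym (<⇒# 0<x)))

  recip-inverseˡ : ∀ x (0<x : 0# < x) → recip x 0<x * x ≈ 1#
  recip-inverseˡ x 0<x = trans (*-congˡ (sym (x-0≈x x)))
    (proj₁ (proj₂ (#⇒invertible (#-sym (<⇒# 0<x)))))

  ∑ : ∀ {a} {A : Set a} → List A → (A → Carrier) → Carrier
  ∑ xs f = foldr _+_ 0# (map f xs)

  ∑-pos : ∀ {a} {A : Set a} {f : A → Carrier} {x} xs →
          x ∈ xs → (∀ y → 0# < f y) → 0# < ∑ xs f
  ∑-pos (x ∷ [])     _ 0<f = <-respʳ-≈ (sym (+-identityʳ _)) (0<f x)
  ∑-pos (x ∷ y ∷ xs) _ 0<f = +-pos (0<f x) (∑-pos (y ∷ xs) (here ≡.refl) 0<f)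

record Graph : Set₁ where
  infix 4 _~_ _~?_
  field
    order        : ℕ
    {{nonEmpty}} : NonZero order
    _~_          : Rel (Fin order) 0ℓ
    _~?_         : Decidable _~_
    ~-irrefl     : Irreflexive _≡_ _~_
    ~-sym        : Symmetric _~_

  Vertex : Set
  Vertex = Fin order

  degree : Vertex → ℕ
  degree v = count (v ~?_) (allFin order)

open Graph using (order; Vertex)

Regular : ℕ → Graph → Set
Regular d G = ∀ v → Graph.degree G v ≡ d

K : ∀ n .{{_ : NonZero n}} → Graph
K n@(suc _) = record
  { order    = n
  ; _~_      = _≢_
  ; _~?_     = λ u v → ¬? (u ≟ v)
  ; ~-irrefl = λ u≡v u≢v → u≢v u≡v
  ; ~-sym    = ≡.≢-sym
  }

-- G is isomorphic to the graph on Fin copies × Vertex H whose edges join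
-- (i , a) to (i , b) for a and b adjacent in H.

record IsDisjointUnionOfCopiesOf (H G : Graph) : Set where
  private
    module G = Graph G
    module H = Graph H
  field
    copies   : ℕ
    vertices : Vertex G ↔ (Fin copies × Vertex H)

  component : Vertex G → Fin copies
  component v = proj₁ (Inverse.to vertices v)

  position : Vertex G → Vertex H
  position v = proj₂ (Inverse.to vertices v)

  field
    adjacency : ∀ u v →
      u G.~ v ⇔ (component u ≡ component v × position u H.~ position v)

Colouring : ℕ → Set
Colouring = Vec (Fin 3)

colourings : ∀ n → List (Colouring n)
colourings zero    = [] ∷ []
colourings (suc n) = cartesianProductWith _∷_ (List.allFin 3) (colourings n)

∈-colourings : ∀ {n} (χ : Colouring n) → χ ∈ colourings n
∈-colourings []      = here ≡.refl
∈-colourings (i ∷ χ) = ∈-cartesianProductWith⁺ _∷_ (∈-allFin i) (∈-colourings χ)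

X : ∀ {n} → Fin 3 → Colouring n → ℕ
X i χ = count (_≟ i) χ

module _ (G : Graph) where
  open Graph G using (_~_; _~?_)

  IsWidomRowlinson : Colouring (order G) → Set
  IsWidomRowlinson χ =
    ∀ u v → u ~ v → ¬ (lookup χ u ≡ 1F × lookup χ v ≡ 2F)

  isWidomRowlinson? : ∀ χ → Dec (IsWidomRowlinson χ)
  isWidomRowlinson? χ = all? λ u → all? λ v →
    (u ~? v) →-dec ¬? ((lookup χ u ≟ 1F) ×-dec (lookup χ v ≟ 2F))

  Ω : List (Colouring (order G))
  Ω = filter isWidomRowlinson? (colourings (order G))

  0∈Ω : replicate (order G) 0F ∈ Ω
  0∈Ω = ∈-filter⁺ isWidomRowlinson? (∈-colourings _) isWR
    where
    isWR : IsWidomRowlinson (replicate (order G) 0F)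
    isWR u _ _ (χu≡1 , _)
      with () ← ≡.trans (≡.sym (lookup-replicate u 0F)) χu≡1

module WidomRowlinson {c ℓ₁ ℓ₂ ℓ₃} (F : OrderedField c ℓ₁ ℓ₂ ℓ₃) where
  open OrderedField F

  -- z is the activity, λ being reserved.
  module _ (G : Graph) (z : Carrier) where

    weight : Colouring (order G) → Carrier
    weight χ = z ^ (X 1F χ ℕ.+ X 2F χ)

    partition : Carrier
    partition = ∑ (Ω G) weight

    partition-pos : 0# < z → 0# < partition
    partition-pos 0<z = ∑-pos (Ω G) (0∈Ω G) λ χ → ^-pos (X 1F χ ℕ.+ X 2F χ) 0<z

    module _ (0<z : 0# < z) where

      ℙ : Colouring (order G) → Carrier
      ℙ χ = weight χ * recip partition (partition-pos 0<z)

      𝔼 : (Colouring (order G) → Carrier) → Carrier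
      𝔼 Y = ∑ (Ω G) λ χ → ℙ χ * Y χ

      occupancyFraction : Carrier
      occupancyFraction =
        𝔼 (λ χ → fromℕ (X 1F χ ℕ.+ X 2F χ))
          * recip (fromℕ (order G)) (fromℕ-pos (order G))

{-# OPTIONS --safe #-}
module Submission where

-- Write y = 1 + z and q = y ^ d.  Let v have colour 0.  Recolouring v with 1 is possible exactly
-- when no neighbour has colour 2, and multiplies the weight by z; this expresses the
-- occupancy of v through the configurations with v coloured 0.  If moreover the vertices coloured 2
-- and all colours outside the neighbourhood of v are fixed, the neighbours coloured 1 form an
-- arbitrary subset of a set of a ≤ d available ones.  The mean size of a random nonempty such
-- subset is (z / y) a / (1 - y ^ -a), which increases with a, hence is at most its value at a = d.
-- By the symmetry of the colours 1 and 2 this bounds a combination of the occupancies of v and of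
-- its neighbours.  In the sum over v every vertex is a neighbour d times, which gives
-- (2q - 1 + 2qz) α ≤ 2qz.
--
-- The configurations with v coloured 0 and both other colours among its neighbours make the
-- inequality strict.  They exist as soon as two distinct neighbours of v are not adjacent.
-- If this never happens, then a = d whenever no neighbour of v has colour 2, every step is an
-- equality, and the graph is a disjoint union of cliques.

open import Defs
import Algebra.Apartness.Properties.HeytingCommutativeRing as HeytingProperties
open import Algebra.Bundles using (CommutativeRing)
open import Data.Bool using (if_then_else_; true; false)
open import Data.Empty using (⊥-elim)
open import Data.Fin as Fin using (Fin; zero; suc; _≟_)
open import Data.Fin.Patterns using (0F; 1F; 2F)
import Data.Fin.Properties as Finₚ
open import Data.List as List using (List; []; _∷_; _++_; filter; length; tabulate; cartesianProductWith)
import Data.List.Properties as Listₚ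
open import Data.List.Membership.Propositional using (_∈_)
open import Data.List.Membership.Propositional.Properties using (∈-filter⁺; ∈-filter⁻; ∈-allFin; ∈-lookup)
open import Data.List.Relation.Unary.All as All using (All; []; _∷_)
open import Data.List.Relation.Unary.AllPairs using ([]; _∷_)
open import Data.List.Relation.Unary.Any as Any using (here; there)
open import Data.List.Relation.Unary.Any.Properties using (lookup-index)
open import Data.List.Relation.Unary.Unique.Propositional using (Unique)
import Data.List.Relation.Unary.Unique.Propositional.Properties as Uniqueₚ
open import Data.Nat as ℕ using (ℕ; zero; suc)
import Data.Nat.Properties as ℕₚ
open import Data.Product using (_×_; _,_; proj₁; proj₂; ∃-syntax)
open import Data.Sum as Sum using (_⊎_; inj₁; inj₂)
open import Data.Vec as Vec using ([]; _∷_; lookup; _[_]≔_)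
import Data.Vec.Properties as Vecₚ
open import Function using (_∘_; id; case_of_; mk↔ₛ′; mk⇔; _⇔_; Injection; Equivalence)
open import Function.Properties.Inverse using (↔⇒↣)
open import Level using (Level)
open import Relation.Binary.Bundles using (StrictPartialOrder)
import Relation.Binary.Construct.StrictToNonStrict as StrictToNonStrict
open import Relation.Binary.PropositionalEquality as ≡ using (_≡_; _≢_)
open import Relation.Nullary using (¬_; Dec; does; yes; no; ¬?; _×-dec_; _⊎-dec_; _→-dec_)
open import Relation.Nullary.Decidable using (decidable-stable; toSum)
open import Relation.Unary using (Pred) renaming (Decidable to Decidable₁)

private variable
  a b p : Level
  A : Set a
  B : Set b

-- Counting in finite lists.

count-tabulate : ∀ {P : Pred A p} (P? : Decidable₁ P) {n} (f : Fin n → A) →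
                 Vec.count P? (Vec.tabulate f) ≡ length (filter P? (tabulate f))
count-tabulate P? {zero}  f = ≡.refl
count-tabulate P? {suc n} f with does (P? (f 0F))
... | true  = ≡.cong suc (count-tabulate P? (f ∘ suc))
... | false = count-tabulate P? (f ∘ suc)

length-filter-⊎ : ∀ {q} {P : Pred A p} {Q : Pred A q} (P? : Decidable₁ P) (Q? : Decidable₁ Q) →
  (∀ x → P x → ¬ Q x) → ∀ xs →
  length (filter (λ x → P? x ⊎-dec Q? x) xs) ≡ length (filter P? xs) ℕ.+ length (filter Q? xs)
length-filter-⊎ P? Q? disjoint []       = ≡.refl
length-filter-⊎ P? Q? disjoint (x ∷ xs) with ih ← length-filter-⊎ P? Q? disjoint xs | P? x | Q? x
... | yes Px | yes Qx = ⊥-elim (disjoint x Px Qx)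
... | yes _  | no _   = ≡.cong suc ih
... | no _   | yes _  = ≡.trans (≡.cong suc ih) (≡.sym (ℕₚ.+-suc _ _))
... | no _   | no _   = ih

length-filter-≡ : ∀ {n} {v : Fin n} {xs} → Unique xs → v ∈ xs → length (filter (v ≟_) xs) ≡ 1
length-filter-≡ {v = v} (v∉xs ∷ _) (here ≡.refl) = ≡.cong length
  (≡.trans (Listₚ.filter-accept (v ≟_) ≡.refl) (≡.cong (v ∷_) (Listₚ.filter-none (v ≟_) v∉xs)))
length-filter-≡ {v = v} (x∉xs ∷ uniq) (there v∈xs) =
  ≡.trans (≡.cong length (Listₚ.filter-reject (v ≟_) (λ v≡x → All.lookup x∉xs v∈xs (≡.sym v≡x))))
          (length-filter-≡ uniq v∈xs)

lookup-injective : ∀ {xs : List A} → Unique xs → ∀ i j → List.lookup xs i ≡ List.lookup xs j → i ≡ j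
lookup-injective (_ ∷ _)    zero    zero    _  = ≡.refl
lookup-injective (x∉ ∷ _)   zero    (suc j) eq = ⊥-elim (All.lookup x∉ (∈-lookup j) eq)
lookup-injective (x∉ ∷ _)   (suc i) zero    eq = ⊥-elim (All.lookup x∉ (∈-lookup i) (≡.sym eq))
lookup-injective (_ ∷ uniq) (suc i) (suc j) eq = ≡.cong suc (lookup-injective uniq i j eq)

-- Gives all lists of the same length one common index type. The length proof is irrelevant, so that
-- equal lists have equal entries whatever proofs accompany them.
lookupAt : ∀ {m} (xs : List A) → .(length xs ≡ m) → Fin m → A
lookupAt xs len j = List.lookup xs (Fin.cast (≡.sym len) j)

-- Disjoint unions of complete graphs

-- Excludes induced paths on three vertices. Among `d`-regular graphs this characterises the
-- disjoint unions of copies of `K (suc d)`, and it is the condition that the analysis of equality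
-- tests.
Clustered : Graph → Set
Clustered G = ∀ {v u u′} → v ~ u → v ~ u′ → u ≢ u′ → u ~ u′
  where open Graph G

K-clustered : ∀ d → Clustered (K (suc d))
K-clustered d _ _ u≢u′ = u≢u′

-- The vertex list splits into `v` itself, found exactly once, and the vertices different from `v`.
K-regular : ∀ d → Regular d (K (suc d))
K-regular d v = ℕₚ.suc-injective (begin
  suc (Graph.degree (K (suc d)) v)                       ≡⟨ ≡.cong suc (count-tabulate (λ u → ¬? (v ≟ u)) id) ⟩
  1 ℕ.+ length (filter (λ u → ¬? (v ≟ u)) V)             ≡⟨ ≡.cong (ℕ._+ length (filter (λ u → ¬? (v ≟ u)) V)) (length-filter-≡ (Uniqueₚ.allFin⁺ (suc d)) (∈-allFin v)) ⟨
  length (filter (v ≟_) V) ℕ.+ length (filter (λ u → ¬? (v ≟ u)) V)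
    ≡⟨ length-filter-⊎ (v ≟_) (λ u → ¬? (v ≟ u)) (λ _ v≡u v≢u → v≢u v≡u) V ⟨
  length (filter (λ u → (v ≟ u) ⊎-dec ¬? (v ≟ u)) V)
    ≡⟨ ≡.cong length (Listₚ.filter-all (λ u → (v ≟ u) ⊎-dec ¬? (v ≟ u)) (All.universal (λ u → toSum (v ≟ u)) V)) ⟩
  length V                                               ≡⟨ Listₚ.length-tabulate id ⟩
  suc d                                                  ∎)
  where
  open ≡.≡-Reasoning
  V = List.allFin (suc d)

-- Two neighbours of `v` share its component; being distinct they have distinct positions there, and
-- distinct positions are adjacent in a complete graph.
disjointUnion⇒clustered : ∀ {d G} → IsDisjointUnionOfCopiesOf (K (suc d)) G → Clustered G
disjointUnion⇒clustered {d} {G} union {v} {u} {u′} v~u v~u′ u≢u′ = from (adjacency u u′)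
  (same , λ pos≡ → u≢u′ (Injection.injective (↔⇒↣ vertices) (≡.cong₂ _,_ same pos≡)))
  where
  open IsDisjointUnionOfCopiesOf union
  open Equivalence using (to; from)
  same : component u ≡ component u′
  same = ≡.trans (≡.sym (proj₁ (to (adjacency v u) v~u))) (proj₁ (to (adjacency v u′) v~u′))

module _ {d} (G : Graph) (regular : Regular d G) (clustered : Clustered G) where
  open Graph G

  private
    V : List Vertex
    V = List.allFin order

    infix 4 _≈_
    -- Clustering makes this an equivalence relation, whose classes are the cliques sought.
    _≈_ : Vertex → Vertex → Set
    u ≈ v = u ≡ v ⊎ u ~ v

    ≈-sym : ∀ {u v} → u ≈ v → v ≈ u
    ≈-sym = Sum.map ≡.sym ~-sym

    ≈-trans : ∀ {u v x} → u ≈ v → v ≈ x → u ≈ x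
    ≈-trans (inj₁ ≡.refl) v≈x           = v≈x
    ≈-trans (inj₂ u~v)    (inj₁ ≡.refl) = inj₂ u~v
    ≈-trans {u} {_} {x} (inj₂ u~v) (inj₂ v~x) with u ≟ x
    ... | yes u≡x = inj₁ u≡x
    ... | no  u≢x = inj₂ (clustered (~-sym u~v) v~x u≢x)

    _≈?_ : ∀ u v → Dec (u ≈ v)
    u ≈? v = (u ≟ v) ⊎-dec (u ~? v)

    cluster : Vertex → List Vertex
    cluster v = filter (v ≈?_) V

    cluster-unique : ∀ v → Unique (cluster v)
    cluster-unique v = Uniqueₚ.filter⁺ (v ≈?_) (Uniqueₚ.allFin⁺ order)

    length-cluster : ∀ v → length (cluster v) ≡ suc d
    length-cluster v = ≡.trans
      (length-filter-⊎ (v ≟_) (v ~?_) (λ _ → ~-irrefl) V)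
      (≡.cong₂ ℕ._+_ (length-filter-≡ (Uniqueₚ.allFin⁺ order) (∈-allFin v))
                     (≡.trans (≡.sym (count-tabulate (v ~?_) id)) (regular v)))

    member : Vertex → Fin (suc d) → Vertex
    member v = lookupAt (cluster v) (length-cluster v)

    -- Equivalent vertices have literally the same cluster list, because both filter `V` by
    -- predicates with the same extension. The enumeration therefore depends on the class alone.
    member-cong : ∀ {u v} → u ≈ v → ∀ j → member u j ≡ member v j
    member-cong {u} {v} u≈v j = lookupAt-cong (length-cluster u) (length-cluster v)
      (Listₚ.filter-≐ (u ≈?_) (v ≈?_) (≈-trans (≈-sym u≈v) , ≈-trans u≈v) V)
      where
      lookupAt-cong : ∀ {xs ys : List Vertex} .(p : length xs ≡ suc d) .(q : length ys ≡ suc d) →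
                      xs ≡ ys → lookupAt xs p j ≡ lookupAt ys q j
      lookupAt-cong _ _ ≡.refl = ≡.refl

    ≈-member : ∀ v j → v ≈ member v j
    ≈-member v j = proj₂ (∈-filter⁻ (v ≈?_) {xs = V} (∈-lookup {xs = cluster v} (Fin.cast (≡.sym (length-cluster v)) j)))

    member-injective : ∀ v {i j} → member v i ≡ member v j → i ≡ j
    member-injective v {i} {j} eq = Finₚ.toℕ-injective (≡.trans (≡.sym (Finₚ.toℕ-cast _ i))
      (≡.trans (≡.cong Fin.toℕ (lookup-injective (cluster-unique v) _ _ eq)) (Finₚ.toℕ-cast _ j)))

    member-surjective : ∀ {v u} → v ≈ u → ∃[ j ] member v j ≡ u
    member-surjective {v} {u} v≈u = Fin.cast (length-cluster v) (Any.index u∈) ,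
      ≡.trans (≡.cong (List.lookup (cluster v)) (Finₚ.cast-involutive (≡.sym (length-cluster v)) (length-cluster v) (Any.index u∈)))
              (≡.sym (lookup-index u∈))
      where
      u∈ : u ∈ cluster v
      u∈ = ∈-filter⁺ (v ≈?_) (∈-allFin u) v≈u

    -- A canonical representative of the class. Components are numbered by the vertices that are
    -- their own leaders.
    leader : Vertex → Vertex
    leader v = member v 0F

    leaders : List Vertex
    leaders = filter (λ v → leader v ≟ v) V

    leaders-unique : Unique leaders
    leaders-unique = Uniqueₚ.filter⁺ (λ v → leader v ≟ v) (Uniqueₚ.allFin⁺ order)

    leader-lookup : ∀ i → leader (List.lookup leaders i) ≡ List.lookup leaders i
    leader-lookup i = proj₂ (∈-filter⁻ (λ v → leader v ≟ v) {xs = V} (∈-lookup {xs = leaders} i))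

    leader∈leaders : ∀ v → leader v ∈ leaders
    leader∈leaders v = ∈-filter⁺ (λ v → leader v ≟ v) (∈-allFin (leader v)) (≡.sym (member-cong (≈-member v 0F) 0F))

    component : Vertex → Fin (length leaders)
    component v = Any.index (leader∈leaders v)

    lookup-component : ∀ v → List.lookup leaders (component v) ≡ leader v
    lookup-component v = ≡.sym (lookup-index (leader∈leaders v))

    from : Fin (length leaders) × Fin (suc d) → Vertex
    from (i , j) = member (List.lookup leaders i) j

    located : ∀ v → ∃[ j ] from (component v , j) ≡ v
    located v = member-surjective
      (≡.subst (_≈ v) (≡.sym (lookup-component v)) (≈-sym (≈-member v 0F)))

    to : Vertex → Fin (length leaders) × Fin (suc d)
    to v = component v , proj₁ (located v)

    from∘to : ∀ v → from (to v) ≡ v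
    from∘to v = proj₂ (located v)

    -- The two leaders are both equivalent to the common vertex, hence equal; the positions then
    -- agree because a cluster has no repetitions. Together with `from∘to` this yields the other
    -- inverse law.
    from-injective : ∀ {x x′} → from x ≡ from x′ → x ≡ x′
    from-injective {i , j} {i′ , j′} eq = ≡.cong₂ _,_ i≡i′
      (member-injective (List.lookup leaders i)
        (≡.trans eq (≡.cong (λ k → from (k , j′)) (≡.sym i≡i′))))
      where
      r  = List.lookup leaders i
      r′ = List.lookup leaders i′
      r≈r′ : r ≈ r′
      r≈r′ = ≈-trans (≡.subst (r ≈_) eq (≈-member r j)) (≈-sym (≈-member r′ j′))
      i≡i′ : i ≡ i′
      i≡i′ = lookup-injective leaders-unique i i′
        (≡.trans (≡.sym (leader-lookup i)) (≡.trans (member-cong r≈r′ 0F) (leader-lookup i′)))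

    to-injective : ∀ {u v} → to u ≡ to v → u ≡ v
    to-injective {u} {v} eq = ≡.trans (≡.sym (from∘to u)) (≡.trans (≡.cong from eq) (from∘to v))

    ≈⇒component≡ : ∀ {u v} → u ≈ v → component u ≡ component v
    ≈⇒component≡ {u} {v} u≈v = lookup-injective leaders-unique _ _
      (≡.trans (lookup-component u) (≡.trans (member-cong u≈v 0F) (≡.sym (lookup-component v))))

    component≡⇒≈ : ∀ {u v} → component u ≡ component v → u ≈ v
    component≡⇒≈ {u} {v} eq = ≈-trans (≈-member u 0F) (≈-trans (inj₁ leader≡) (≈-sym (≈-member v 0F)))
      where
      leader≡ : leader u ≡ leader v
      leader≡ = ≡.trans (≡.sym (lookup-component u))
        (≡.trans (≡.cong (List.lookup leaders) eq) (lookup-component v))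

  clustered⇒disjointUnion : IsDisjointUnionOfCopiesOf (K (suc d)) G
  clustered⇒disjointUnion = record
    { copies    = length leaders
    ; vertices  = mk↔ₛ′ to from (λ x → from-injective (from∘to (from x))) from∘to
    ; adjacency = λ u v → mk⇔
        (λ u~v → let same = ≈⇒component≡ (inj₂ u~v) in
          same , λ pos≡ → ~-irrefl (to-injective (≡.cong₂ _,_ same pos≡)) u~v)
        (λ (same , pos≢) → case component≡⇒≈ same of λ where
          (inj₁ u≡v) → ⊥-elim (pos≢ (≡.cong (proj₂ ∘ to) u≡v))
          (inj₂ u~v) → u~v)
    }

-- Recolouring

swap : Fin 3 → Fin 3
swap 0F = 0F
swap 1F = 2F
swap 2F = 1F

X-recolour-≡ : ∀ {n} i (u : Fin n) (χ : Colouring n) → i ≢ 0F → lookup χ u ≡ 0F →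
               X i (χ [ u ]≔ i) ≡ suc (X i χ)
X-recolour-≡ i zero    (0F ∷ χ) i≢0 ≡.refl with i ≟ i | 0F ≟ i
... | yes _  | no _    = ≡.refl
... | yes _  | yes 0≡i = ⊥-elim (i≢0 (≡.sym 0≡i))
... | no i≢i | _       = ⊥-elim (i≢i ≡.refl)
X-recolour-≡ i (suc u) (j ∷ χ)  i≢0 χu≡0 with does (j ≟ i)
... | true  = ≡.cong suc (X-recolour-≡ i u χ i≢0 χu≡0)
... | false = X-recolour-≡ i u χ i≢0 χu≡0

X-recolour-≢ : ∀ {n} i j (u : Fin n) (χ : Colouring n) → i ≢ 0F → i ≢ j → lookup χ u ≡ 0F →
               X i (χ [ u ]≔ j) ≡ X i χ
X-recolour-≢ i j zero    (0F ∷ χ) i≢0 i≢j ≡.refl with j ≟ i | 0F ≟ i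
... | no _    | no _    = ≡.refl
... | _       | yes 0≡i = ⊥-elim (i≢0 (≡.sym 0≡i))
... | yes j≡i | _       = ⊥-elim (i≢j (≡.sym j≡i))
X-recolour-≢ i j (suc u) (k ∷ χ)  i≢0 i≢j χu≡0 with does (k ≟ i)
... | true  = ≡.cong suc (X-recolour-≢ i j u χ i≢0 i≢j χu≡0)
... | false = X-recolour-≢ i j u χ i≢0 i≢j χu≡0

X₁-swap : ∀ {n} (χ : Colouring n) → X 1F (Vec.map swap χ) ≡ X 2F χ
X₁-swap []       = ≡.refl
X₁-swap (0F ∷ χ) = X₁-swap χ
X₁-swap (1F ∷ χ) = X₁-swap χ
X₁-swap (2F ∷ χ) = ≡.cong suc (X₁-swap χ)

X₂-swap : ∀ {n} (χ : Colouring n) → X 2F (Vec.map swap χ) ≡ X 1F χ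
X₂-swap []       = ≡.refl
X₂-swap (0F ∷ χ) = X₂-swap χ
X₂-swap (1F ∷ χ) = ≡.cong suc (X₂-swap χ)
X₂-swap (2F ∷ χ) = X₂-swap χ

swap-involutive : ∀ i → swap (swap i) ≡ i
swap-involutive 0F = ≡.refl
swap-involutive 1F = ≡.refl
swap-involutive 2F = ≡.refl

lookup-swap : ∀ {n} (χ : Colouring n) v {i} → lookup (Vec.map swap χ) v ≡ i → lookup χ v ≡ swap i
lookup-swap χ v ≡.refl = ≡.sym (≡.trans (≡.cong swap (Vecₚ.lookup-map v swap χ)) (swap-involutive _))

lookup-swap⁻¹ : ∀ {n} (χ : Colouring n) v {i} → lookup χ v ≡ swap i → lookup (Vec.map swap χ) v ≡ i
lookup-swap⁻¹ χ v {i} eq = ≡.trans (Vecₚ.lookup-map v swap χ) (≡.trans (≡.cong swap eq) (swap-involutive i))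

module OccupancyBound {c ℓ₁ ℓ₂ ℓ₃} (F : OrderedField c ℓ₁ ℓ₂ ℓ₃) where

  open OrderedField F
    using ( _<_; _≤_; 0<1; +-pos; *-pos; ^-pos; fromℕ; fromℕ-pos; recip; recip-inverseˡ; _^_; ∑
          ; +-monoˡ-<; isStrictPartialOrder; <-irrefl; <-asym; <-trans; <-respˡ-≈; <-respʳ-≈
          ; heytingCommutativeRing; #⇒<⊎>)
    public
  open CommutativeRing (OrderedField.commutativeRing F) public hiding (_-_; zero)
  open import Algebra.Properties.CommutativeSemigroup *-commutativeSemigroup
    using () renaming (x∙yz≈y∙xz to x*yz≈y*xz)
  open import Algebra.Properties.Group +-group using () renaming (∙-cancelˡ to +-cancelˡ)
  open import Algebra.Properties.Semiring.Exp semiring using (^-homo-*)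
  open import Algebra.Properties.Semiring.Mult semiring using (×-homo-+)
  open import Algebra.Solver.Ring.NaturalCoefficients.Default commutativeSemiring
    using (solve; _:=_; _:+_; _:*_; con)
  -- x ⊑ y is x < y ⊎ x ≈ y, which is stronger than x ≤ y.  All the inequalities below are
  -- decided in this sense, so that cotransitivity is never needed.
  open StrictToNonStrict _≈_ _<_ public using () renaming (_≤_ to _⊑_)

  strictPartialOrder : StrictPartialOrder c ℓ₁ ℓ₃
  strictPartialOrder = record { isStrictPartialOrder = isStrictPartialOrder }

  module ⊑-Reasoning where
    open import Relation.Binary.Reasoning.StrictPartialOrder strictPartialOrder public

  open ⊑-Reasoning

  -- Arithmetic of the order in an ordered field.

  ⊑-trans : ∀ {x y z} → x ⊑ y → y ⊑ z → x ⊑ z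
  ⊑-trans = StrictToNonStrict.trans _≈_ _<_ isEquivalence (<-respʳ-≈ , <-respˡ-≈) <-trans

  ⊑⇒≤ : ∀ {x y} → x ⊑ y → x ≤ y
  ⊑⇒≤ (inj₁ x<y) y<x = <-asym x<y y<x
  ⊑⇒≤ (inj₂ x≈y) y<x = <-irrefl (sym x≈y) y<x

  +-monoʳ-< : ∀ z {x y} → x < y → z + x < z + y
  +-monoʳ-< z x<y = <-respˡ-≈ (+-comm _ z) (<-respʳ-≈ (+-comm _ z) (+-monoˡ-< z x<y))

  +-monoʳ-⊑ : ∀ z {x y} → x ⊑ y → z + x ⊑ z + y
  +-monoʳ-⊑ z (inj₁ x<y) = inj₁ (+-monoʳ-< z x<y)
  +-monoʳ-⊑ z (inj₂ x≈y) = inj₂ (+-congˡ x≈y)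

  +-monoˡ-⊑ : ∀ z {x y} → x ⊑ y → x + z ⊑ y + z
  +-monoˡ-⊑ z (inj₁ x<y) = inj₁ (+-monoˡ-< z x<y)
  +-monoˡ-⊑ z (inj₂ x≈y) = inj₂ (+-congʳ x≈y)

  +-mono-⊑ : ∀ {w x y z} → w ⊑ x → y ⊑ z → w + y ⊑ x + z
  +-mono-⊑ w⊑x y⊑z = ⊑-trans (+-monoˡ-⊑ _ w⊑x) (+-monoʳ-⊑ _ y⊑z)

  +-mono-⊑-< : ∀ {w x y z} → w ⊑ x → y < z → w + y < x + z
  +-mono-⊑-< {w} {x} {y} {z} w⊑x y<z = begin-strict
    w + y  ≤⟨ +-monoˡ-⊑ y w⊑x ⟩
    x + y  <⟨ +-monoʳ-< x y<z ⟩
    x + z  ∎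

  +-mono-<-⊑ : ∀ {w x y z} → w < x → y ⊑ z → w + y < x + z
  +-mono-<-⊑ {w} {x} {y} {z} w<x y⊑z = begin-strict
    w + y  <⟨ +-monoˡ-< y w<x ⟩
    x + y  ≤⟨ +-monoʳ-⊑ x y⊑z ⟩
    x + z  ∎

  0⊑+ : ∀ {x y} → 0# ⊑ x → 0# ⊑ y → 0# ⊑ x + y
  0⊑+ {x} {y} 0⊑x 0⊑y = begin
    0#       ≈⟨ +-identityʳ 0# ⟨
    0# + 0#  ≤⟨ +-mono-⊑ 0⊑x 0⊑y ⟩
    x + y    ∎

  x⊑x+y : ∀ x {y} → 0# ⊑ y → x ⊑ x + y
  x⊑x+y x {y} 0⊑y = begin
    x       ≈⟨ +-identityʳ x ⟨
    x + 0#  ≤⟨ +-monoʳ-⊑ x 0⊑y ⟩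
    x + y   ∎

  x⊑y+x : ∀ x {y} → 0# ⊑ y → x ⊑ y + x
  x⊑y+x x 0⊑y = ⊑-trans (x⊑x+y x 0⊑y) (inj₂ (+-comm _ _))

  0<y-x : ∀ {x y} → x < y → 0# < y + (- x)
  0<y-x {x} x<y = <-respˡ-≈ (-‿inverseʳ x) (+-monoˡ-< (- x) x<y)

  -- The axioms speak only of products of positive elements, so the difference of `y` and `x` is
  -- multiplied by `c` and `c * x` is added back.
  *-monoʳ-< : ∀ {c x y} → 0# < c → x < y → c * x < c * y
  *-monoʳ-< {c} {x} {y} 0<c x<y = begin-strict
    c * x                    ≈⟨ +-identityˡ (c * x) ⟨
    0# + c * x               <⟨ +-monoˡ-< (c * x) (*-pos 0<c (0<y-x x<y)) ⟩
    c * (y + (- x)) + c * x  ≈⟨ distribˡ c _ x ⟨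
    c * (y + (- x) + x)      ≈⟨ *-congˡ (trans (+-assoc y _ x) (trans (+-congˡ (-‿inverseˡ x)) (+-identityʳ y))) ⟩
    c * y                    ∎

  *-monoʳ-⊑ : ∀ {c x y} → 0# ⊑ c → x ⊑ y → c * x ⊑ c * y
  *-monoʳ-⊑ (inj₁ 0<c) (inj₁ x<y) = inj₁ (*-monoʳ-< 0<c x<y)
  *-monoʳ-⊑ (inj₂ 0≈c) (inj₁ x<y) = inj₂ (trans (trans (*-congʳ (sym 0≈c)) (zeroˡ _)) (trans (sym (zeroˡ _)) (*-congʳ 0≈c)))
  *-monoʳ-⊑ _          (inj₂ x≈y) = inj₂ (*-congˡ x≈y)

  *-monoˡ-⊑ : ∀ {c x y} → 0# ⊑ c → x ⊑ y → x * c ⊑ y * c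
  *-monoˡ-⊑ {c} {x} {y} 0⊑c x⊑y = begin
    x * c  ≈⟨ *-comm x c ⟩
    c * x  ≤⟨ *-monoʳ-⊑ 0⊑c x⊑y ⟩
    c * y  ≈⟨ *-comm c y ⟩
    y * c  ∎

  0⊑* : ∀ {x y} → 0# ⊑ x → 0# ⊑ y → 0# ⊑ x * y
  0⊑* {x} 0⊑x 0⊑y = ⊑-trans (inj₂ (sym (zeroʳ x))) (*-monoʳ-⊑ 0⊑x 0⊑y)

  -- The reciprocal is invertible, hence apart from zero, hence positive or negative; if it were
  -- negative, multiplication by `x` would give 1 < 0.
  recip-pos : ∀ x (0<x : 0# < x) → 0# < recip x 0<x
  recip-pos x 0<x with #⇒<⊎> recip#0
    where
    open HeytingProperties heytingCommutativeRing using (invertibleˡ⇒#; x-0≈x)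
    recip#0 : OrderedField._#_ F (recip x 0<x) 0#
    recip#0 = invertibleˡ⇒#
      (x , trans (*-congˡ (x-0≈x _)) (trans (*-comm x _) (recip-inverseˡ x 0<x)))
  ... | inj₂ 0<x⁻¹ = 0<x⁻¹
  ... | inj₁ x⁻¹<0 = ⊥-elim (<-asym 0<1 (begin-strict
    1#               ≈⟨ recip-inverseˡ x 0<x ⟨
    recip x 0<x * x  ≈⟨ *-comm _ x ⟩
    x * recip x 0<x  <⟨ *-monoʳ-< 0<x x⁻¹<0 ⟩
    x * 0#           ≈⟨ zeroʳ x ⟩
    0#               ∎))

  recip-cancelˡ : ∀ x (0<x : 0# < x) t → recip x 0<x * (x * t) ≈ t
  recip-cancelˡ x 0<x t =
    trans (sym (*-assoc _ x t)) (trans (*-congʳ (recip-inverseˡ x 0<x)) (*-identityˡ t))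

  *-cancelˡ-⊑ : ∀ {c x y} → 0# < c → c * x ⊑ c * y → x ⊑ y
  *-cancelˡ-⊑ {c} {x} {y} 0<c cx⊑cy = begin
    x                      ≈⟨ recip-cancelˡ c 0<c x ⟨
    recip c 0<c * (c * x)  ≤⟨ *-monoʳ-⊑ (inj₁ (recip-pos c 0<c)) cx⊑cy ⟩
    recip c 0<c * (c * y)  ≈⟨ recip-cancelˡ c 0<c y ⟩
    y                      ∎

  *-cancelˡ-< : ∀ {c x y} → 0# < c → c * x < c * y → x < y
  *-cancelˡ-< {c} {x} {y} 0<c cx<cy = begin-strict
    x                      ≈⟨ recip-cancelˡ c 0<c x ⟨
    recip c 0<c * (c * x)  <⟨ *-monoʳ-< (recip-pos c 0<c) cx<cy ⟩
    recip c 0<c * (c * y)  ≈⟨ recip-cancelˡ c 0<c y ⟩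
    y                      ∎

  *-cancelˡ : ∀ {c x y} → 0# < c → c * x ≈ c * y → x ≈ y
  *-cancelˡ {c} {x} {y} 0<c cx≈cy =
    trans (sym (recip-cancelˡ c 0<c x)) (trans (*-congˡ cx≈cy) (recip-cancelˡ c 0<c y))

  0⊑fromℕ : ∀ n → 0# ⊑ fromℕ n
  0⊑fromℕ zero    = inj₂ refl
  0⊑fromℕ (suc n) = inj₁ (fromℕ-pos (suc n))

  -- Powers of 1 + z and the monotonicity of a / (1 - y ^ -a).

  module Powers (z : Carrier) (0<z : 0# < z) where

    y : Carrier
    y = 1# + z

    0<y : 0# < y
    0<y = +-pos 0<1 0<z

    1⊑y : 1# ⊑ y
    1⊑y = x⊑x+y 1# (inj₁ 0<z)

    -- y ^ n - 1, without subtraction so that the semiring solver applies.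
    pow-1 : ℕ → Carrier
    pow-1 zero    = 0#
    pow-1 (suc n) = z + y * pow-1 n

    y^n≈1+pow-1 : ∀ n → y ^ n ≈ 1# + pow-1 n
    y^n≈1+pow-1 zero    = sym (+-identityʳ 1#)
    y^n≈1+pow-1 (suc n) = trans (*-congˡ (y^n≈1+pow-1 n))
      (solve 2 (λ z p → (con 1 :+ z) :* (con 1 :+ p) := con 1 :+ (z :+ (con 1 :+ z) :* p)) refl z (pow-1 n))

    0⊑pow-1 : ∀ n → 0# ⊑ pow-1 n
    0⊑pow-1 zero    = inj₂ refl
    0⊑pow-1 (suc n) = 0⊑+ (inj₁ 0<z) (0⊑* (inj₁ 0<y) (0⊑pow-1 n))

    1⊑y^n : ∀ n → 1# ⊑ y ^ n
    1⊑y^n n = ⊑-trans (x⊑x+y 1# (0⊑pow-1 n)) (inj₂ (sym (y^n≈1+pow-1 n)))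

    0⊑y^n : ∀ n → 0# ⊑ y ^ n
    0⊑y^n n = inj₁ (^-pos n 0<y)

    pow-1-+ : ∀ m a → pow-1 (m ℕ.+ a) ≈ pow-1 m + y ^ m * pow-1 a
    pow-1-+ zero    a = sym (trans (+-identityˡ _) (*-identityˡ _))
    pow-1-+ (suc m) a = trans (+-congˡ (*-congˡ (pow-1-+ m a)))
      (solve 5 (λ z y pₘ b pₐ → z :+ y :* (pₘ :+ b :* pₐ) := z :+ y :* pₘ :+ y :* b :* pₐ)
        refl z y (pow-1 m) (y ^ m) (pow-1 a))

    -- The geometric sum: y ^ m - 1 is z times the sum of `m` lower powers of `y`, each at most y ^
    -- m.
    pow-1-⊑ : ∀ m → pow-1 m ⊑ fromℕ m * y ^ m * z
    pow-1-⊑ zero    = inj₂ (sym (trans (*-congʳ (zeroˡ _)) (zeroˡ z)))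
    pow-1-⊑ (suc m) = begin
      z + y * pow-1 m                      ≈⟨ +-congʳ (*-identityˡ z) ⟨
      1# * z + y * pow-1 m                 ≤⟨ +-mono-⊑ (*-monoˡ-⊑ (inj₁ 0<z) (1⊑y^n (suc m)))
                                                       (*-monoʳ-⊑ (inj₁ 0<y) (pow-1-⊑ m)) ⟩
      y * y ^ m * z + y * (fromℕ m * y ^ m * z)
        ≈⟨ solve 4 (λ y b z m → y :* b :* z :+ y :* (m :* b :* z) := (con 1 :+ m) :* (y :* b) :* z)
             refl y (y ^ m) z (fromℕ m) ⟩
      fromℕ (suc m) * y ^ suc m * z        ∎

    -- (1 - y ^ -m) / m ≤ z ≤ (y ^ a - 1) / a, cleared of denominators.
    fromℕ*pow-1-⊑ : ∀ a m → fromℕ a * pow-1 m ⊑ fromℕ m * y ^ m * pow-1 a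
    fromℕ*pow-1-⊑ zero    m = inj₂ (trans (zeroˡ _) (sym (zeroʳ _)))
    fromℕ*pow-1-⊑ (suc a) m = begin
      (1# + fromℕ a) * pow-1 m             ≈⟨ solve 2 (λ a p → (con 1 :+ a) :* p := p :+ a :* p) refl (fromℕ a) (pow-1 m) ⟩
      pow-1 m + fromℕ a * pow-1 m          ≤⟨ +-mono-⊑ (pow-1-⊑ m) (fromℕ*pow-1-⊑ a m) ⟩
      k * z + k * pow-1 a                  ≈⟨ distribˡ k z _ ⟨
      k * (z + pow-1 a)                    ≤⟨ *-monoʳ-⊑ 0⊑k (+-monoʳ-⊑ z p⊑yp) ⟩
      k * pow-1 (suc a)                    ∎
      where
      k = fromℕ m * y ^ m
      0⊑k = 0⊑* (0⊑fromℕ m) (0⊑y^n m)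
      p⊑yp : pow-1 a ⊑ y * pow-1 a
      p⊑yp = ⊑-trans (inj₂ (sym (*-identityˡ _))) (*-monoˡ-⊑ (0⊑pow-1 a) 1⊑y)

    -- a / (1 - y ^ -a) increases with a.
    power-ratio-⊑ : ∀ {a d} → a ℕ.≤ d →
                    fromℕ a * y ^ a * pow-1 d ⊑ fromℕ d * (y ^ d * pow-1 a)
    power-ratio-⊑ {a} {d} a≤d with d ℕ.∸ a | ℕₚ.m∸n+n≡m a≤d
    ... | m | ≡.refl = begin
      fromℕ a * y ^ a * pow-1 (m ℕ.+ a)    ≈⟨ *-congˡ (pow-1-+ m a) ⟩
      fromℕ a * y ^ a * (pow-1 m + y ^ m * pow-1 a)
        ≈⟨ solve 5 (λ a yᵃ yᵐ pᵐ pᵃ → a :* yᵃ :* (pᵐ :+ yᵐ :* pᵃ) := yᵃ :* (a :* pᵐ) :+ a :* yᵐ :* yᵃ :* pᵃ)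
             refl (fromℕ a) (y ^ a) (y ^ m) (pow-1 m) (pow-1 a) ⟩
      y ^ a * (fromℕ a * pow-1 m) + fromℕ a * y ^ m * y ^ a * pow-1 a
        ≤⟨ +-monoˡ-⊑ _ (*-monoʳ-⊑ (0⊑y^n a) (fromℕ*pow-1-⊑ a m)) ⟩
      y ^ a * (fromℕ m * y ^ m * pow-1 a) + fromℕ a * y ^ m * y ^ a * pow-1 a
        ≈⟨ solve 5 (λ a m yᵃ yᵐ pᵃ → yᵃ :* (m :* yᵐ :* pᵃ) :+ a :* yᵐ :* yᵃ :* pᵃ := (m :+ a) :* (yᵐ :* yᵃ :* pᵃ))
             refl (fromℕ a) (fromℕ m) (y ^ a) (y ^ m) (pow-1 a) ⟩
      (fromℕ m + fromℕ a) * (y ^ m * y ^ a * pow-1 a)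
        ≈⟨ *-cong (×-homo-+ 1# m a) (*-congʳ (^-homo-* y m a)) ⟨
      fromℕ (m ℕ.+ a) * (y ^ (m ℕ.+ a) * pow-1 a) ∎

    -- (y ^ d - 1) / d, and 0 when d = 0.
    slope : ℕ → Carrier
    slope zero      = 0#
    slope d@(suc _) = recip (fromℕ d) (fromℕ-pos d) * pow-1 d

    0⊑slope : ∀ d → 0# ⊑ slope d
    0⊑slope zero      = inj₂ refl
    0⊑slope d@(suc _) = 0⊑* (inj₁ (recip-pos _ (fromℕ-pos d))) (0⊑pow-1 d)

    fromℕ*slope : ∀ d → fromℕ d * slope d ≈ pow-1 d
    fromℕ*slope zero      = zeroˡ _
    fromℕ*slope d@(suc _) = trans (sym (*-assoc _ _ _))
      (trans (*-congʳ (trans (*-comm _ _) (recip-inverseˡ _ (fromℕ-pos d)))) (*-identityˡ _))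

    -- This is `power-ratio-⊑` divided by `d`, which is legitimate because a positive `a` forces `d`
    -- to be positive; for `a` zero both sides vanish.
    slope-⊑ : ∀ {a d} → a ℕ.≤ d → slope d * (fromℕ a * y ^ a) ⊑ y ^ d * pow-1 a
    slope-⊑ {zero}  {d} _ = inj₂ (trans (*-congˡ (zeroˡ _)) (trans (zeroʳ _) (sym (zeroʳ _))))
    slope-⊑ {suc a} {d@(suc _)} a≤d = begin
      recip D 0<D * pow-1 d * (fromℕ (suc a) * y ^ suc a)
        ≈⟨ trans (*-assoc _ _ _) (*-congˡ (*-comm _ _)) ⟩
      recip D 0<D * (fromℕ (suc a) * y ^ suc a * pow-1 d)
        ≤⟨ *-monoʳ-⊑ (inj₁ (recip-pos D 0<D)) (power-ratio-⊑ a≤d) ⟩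
      recip D 0<D * (D * (y ^ d * pow-1 (suc a)))
        ≈⟨ recip-cancelˡ D 0<D _ ⟩
      y ^ d * pow-1 (suc a) ∎
      where
      D = fromℕ d
      0<D = fromℕ-pos d

    slope-≈ : ∀ d → slope d * (fromℕ d * y ^ d) ≈ y ^ d * pow-1 d
    slope-≈ d = begin-equality
      slope d * (fromℕ d * y ^ d)  ≈⟨ *-assoc _ _ _ ⟨
      slope d * fromℕ d * y ^ d    ≈⟨ *-congʳ (trans (*-comm _ _) (fromℕ*slope d)) ⟩
      pow-1 d * y ^ d              ≈⟨ *-comm _ _ ⟩
      y ^ d * pow-1 d              ∎

  -- Finite sums

  ∑-cong : ∀ {f g : A → Carrier} (xs : List A) → (∀ x → f x ≈ g x) → ∑ xs f ≈ ∑ xs g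
  ∑-cong []       f≈g = refl
  ∑-cong (x ∷ xs) f≈g = +-cong (f≈g x) (∑-cong xs f≈g)

  ∑-mono : ∀ {f g : A → Carrier} (xs : List A) → (∀ x → f x ⊑ g x) → ∑ xs f ⊑ ∑ xs g
  ∑-mono []       f⊑g = inj₂ refl
  ∑-mono (x ∷ xs) f⊑g = +-mono-⊑ (f⊑g x) (∑-mono xs f⊑g)

  ∑-mono-< : ∀ {f g : A → Carrier} {x xs} → x ∈ xs → (∀ x → f x ⊑ g x) → f x < g x → ∑ xs f < ∑ xs g
  ∑-mono-< {xs = _ ∷ xs} (here ≡.refl) f⊑g fx<gx = +-mono-<-⊑ fx<gx (∑-mono xs f⊑g)
  ∑-mono-< {xs = x ∷ _}  (there x∈xs)  f⊑g fx<gx = +-mono-⊑-< (f⊑g x) (∑-mono-< x∈xs f⊑g fx<gx)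

  ∑-0 : (xs : List A) → ∑ xs (λ _ → 0#) ≈ 0#
  ∑-0 []       = refl
  ∑-0 (x ∷ xs) = trans (+-identityˡ _) (∑-0 xs)

  0<∑ : ∀ {f : A → Carrier} {x xs} → x ∈ xs → (∀ x → 0# ⊑ f x) → 0# < f x → 0# < ∑ xs f
  0<∑ {xs = xs} x∈xs 0⊑f 0<fx = <-respˡ-≈ (∑-0 xs) (∑-mono-< x∈xs 0⊑f 0<fx)

  ∑-+ : ∀ {f g : A → Carrier} (xs : List A) → ∑ xs (λ x → f x + g x) ≈ ∑ xs f + ∑ xs g
  ∑-+ []                   = sym (+-identityˡ 0#)
  ∑-+ {f = f} {g} (x ∷ xs) = trans (+-congˡ (∑-+ xs))
    (solve 4 (λ a b c d → a :+ b :+ (c :+ d) := a :+ c :+ (b :+ d)) refl (f x) (g x) (∑ xs f) (∑ xs g))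

  *-∑ : ∀ k {f : A → Carrier} (xs : List A) → k * ∑ xs f ≈ ∑ xs (λ x → k * f x)
  *-∑ k []       = zeroʳ k
  *-∑ k (x ∷ xs) = trans (distribˡ k _ _) (+-congˡ (*-∑ k xs))

  ∑-* : ∀ k {f : A → Carrier} (xs : List A) → ∑ xs f * k ≈ ∑ xs (λ x → f x * k)
  ∑-* k xs = trans (*-comm _ k) (trans (*-∑ k xs) (∑-cong xs λ _ → *-comm k _))

  ∑-comm : ∀ {f : A → B → Carrier} (xs : List A) (ys : List B) →
           ∑ xs (λ x → ∑ ys (f x)) ≈ ∑ ys (λ y → ∑ xs (λ x → f x y))
  ∑-comm []       ys = sym (∑-0 ys)
  ∑-comm (x ∷ xs) ys = trans (+-congˡ (∑-comm xs ys)) (sym (∑-+ ys))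

  ∑-++ : ∀ {f : A → Carrier} (xs ys : List A) → ∑ (xs ++ ys) f ≈ ∑ xs f + ∑ ys f
  ∑-++ []       ys = sym (+-identityˡ _)
  ∑-++ (x ∷ xs) ys = trans (+-congˡ (∑-++ xs ys)) (sym (+-assoc _ _ _))

  ∑-map : ∀ {f : B → Carrier} {g : A → B} (xs : List A) → ∑ (List.map g xs) f ≈ ∑ xs (f ∘ g)
  ∑-map []       = refl
  ∑-map (x ∷ xs) = +-congˡ (∑-map xs)

  ∑-cartesianProductWith : ∀ {c} {C : Set c} {f : C → Carrier} (g : A → B → C) (xs : List A) (ys : List B) →
    ∑ (cartesianProductWith g xs ys) f ≈ ∑ xs (λ x → ∑ ys (f ∘ g x))
  ∑-cartesianProductWith g []       ys = refl
  ∑-cartesianProductWith g (x ∷ xs) ys =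
    trans (∑-++ (List.map (g x) ys) _) (+-cong (∑-map ys) (∑-cartesianProductWith g xs ys))

  ∑-allFin-suc : ∀ {n} (f : Fin (suc n) → Carrier) →
                 ∑ (List.allFin (suc n)) f ≈ f zero + ∑ (List.allFin n) (f ∘ suc)
  ∑-allFin-suc {n} f = +-congˡ (trans
    (reflexive (≡.cong (λ xs → ∑ xs f) (≡.sym (Listₚ.map-tabulate id suc))))
    (∑-map (List.allFin n)))

  -- Indicators of decidable propositions.

  ind : ∀ {P : Set p} → Dec P → Carrier
  ind P? = if does P? then 1# else 0#

  module _ {P : Set p} where

    ind-yes : (P? : Dec P) → P → ind P? ≈ 1#
    ind-yes (yes _)  _ = refl
    ind-yes (no ¬p)  p = ⊥-elim (¬p p)

    ind-no : (P? : Dec P) → ¬ P → ind P? ≈ 0#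
    ind-no (yes p) ¬p = ⊥-elim (¬p p)
    ind-no (no _)  _  = refl

    0⊑ind : (P? : Dec P) → 0# ⊑ ind P?
    0⊑ind (yes _) = inj₁ 0<1
    0⊑ind (no _)  = inj₂ refl

    0<ind : (P? : Dec P) → P → 0# < ind P?
    0<ind P? p = <-respʳ-≈ (sym (ind-yes P? p)) 0<1

    ind-+-¬ : (P? : Dec P) → ind P? + ind (¬? P?) ≈ 1#
    ind-+-¬ (yes _) = +-identityʳ 1#
    ind-+-¬ (no _)  = +-identityˡ 1#

    ind-idem : (P? : Dec P) → ind P? * ind P? ≈ ind P?
    ind-idem (yes _) = *-identityˡ 1#
    ind-idem (no _)  = zeroˡ 0#

    -- Lets two terms be compared under the assumption `P`, since otherwise the indicator
    -- annihilates both.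
    ind-*-cong : (P? : Dec P) {s t : Carrier} → (P → s ≈ t) → ind P? * s ≈ ind P? * t
    ind-*-cong (yes p) s≈t = *-congˡ (s≈t p)
    ind-*-cong (no _)  s≈t = trans (zeroˡ _) (sym (zeroˡ _))

    ind-cong : ∀ {q} {Q : Set q} (P? : Dec P) (Q? : Dec Q) → (P → Q) → (Q → P) → ind P? ≈ ind Q?
    ind-cong P? (yes q) P→Q Q→P = ind-yes P? (Q→P q)
    ind-cong P? (no ¬q) P→Q Q→P = ind-no P? (¬q ∘ P→Q)

    ind-× : ∀ {q} {Q : Set q} (P? : Dec P) (Q? : Dec Q) → ind (P? ×-dec Q?) ≈ ind P? * ind Q?
    ind-× (yes _) Q? = sym (*-identityˡ _)
    ind-× (no _)  Q? = sym (zeroˡ _)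

  module _ {P : Pred A p} (P? : Decidable₁ P) where

    ∑-filter : ∀ {f : A → Carrier} (xs : List A) → ∑ (filter P? xs) f ≈ ∑ xs (λ x → ind (P? x) * f x)
    ∑-filter []       = refl
    ∑-filter (x ∷ xs) with does (P? x)
    ... | true  = +-cong (sym (*-identityˡ _)) (∑-filter xs)
    ... | false = trans (∑-filter xs) (sym (trans (+-congʳ (zeroˡ _)) (+-identityˡ _)))

    fromℕ-length-filter : (xs : List A) → fromℕ (length (filter P? xs)) ≈ ∑ xs (ind ∘ P?)
    fromℕ-length-filter []       = refl
    fromℕ-length-filter (x ∷ xs) with does (P? x)
    ... | true  = +-congˡ (fromℕ-length-filter xs)
    ... | false = trans (fromℕ-length-filter xs) (sym (+-identityˡ _))

  ∑-1 : ∀ n → ∑ (List.allFin n) (λ _ → 1#) ≈ fromℕ n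
  ∑-1 zero    = refl
  ∑-1 (suc n) = trans (∑-allFin-suc {n} (λ _ → 1#)) (+-congˡ (∑-1 n))

  fromℕ-X : ∀ {n} i (χ : Colouring n) →
            fromℕ (X i χ) ≈ ∑ (List.allFin n) (λ v → ind (lookup χ v ≟ i))
  fromℕ-X i []      = refl
  fromℕ-X i (j ∷ χ) = trans (head (j ≟ i)) (sym (∑-allFin-suc (λ v → ind (lookup (j ∷ χ) v ≟ i))))
    where
    head : (eq? : Dec (j ≡ i)) → fromℕ ((if does eq? then suc else id) (X i χ))
           ≈ ind eq? + ∑ (List.allFin _) (λ v → ind (lookup χ v ≟ i))
    head (yes _) = +-congˡ (fromℕ-X i χ)
    head (no _)  = trans (fromℕ-X i χ) (sym (+-identityˡ _))

  -- Sums over all colourings.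

  Σχ : ∀ {n} → (Colouring n → Carrier) → Carrier
  Σχ {n} = ∑ (colourings n)

  Σχ-∷ : ∀ {n} (f : Colouring (suc n) → Carrier) →
         Σχ f ≈ Σχ (f ∘ (0F ∷_)) + (Σχ (f ∘ (1F ∷_)) + (Σχ (f ∘ (2F ∷_)) + 0#))
  Σχ-∷ {n} f = ∑-cartesianProductWith {f = f} (Vec._∷_ {n = n}) (List.allFin 3) (colourings _)

  -- Meant for `χ` with colour 0 at `u`: it then sums `f` over the three colourings that agree with
  -- `χ` away from `u`.
  fibre : ∀ {n} → Fin n → (Colouring n → Carrier) → Colouring n → Carrier
  fibre u f χ = f χ + (f (χ [ u ]≔ 1F) + f (χ [ u ]≔ 2F))

  -- The colourings are partitioned into such fibres, each represented by its member with colour 0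
  -- at `u`. Every recolouring identity below is checked fibre by fibre in this way.
  Σχ-fibre-cong : ∀ {n} (u : Fin n) {f g : Colouring n → Carrier} →
                  (∀ χ → lookup χ u ≡ 0F → fibre u f χ ≈ fibre u g χ) → Σχ f ≈ Σχ g
  Σχ-fibre-cong {suc n} zero {f} {g} f≈g = trans (collect f)
    (trans (∑-cong (colourings n) (λ χ → f≈g (0F ∷ χ) ≡.refl)) (sym (collect g)))
    where
    collect : ∀ f → Σχ f ≈ Σχ (λ χ → fibre zero f (0F ∷ χ))
    collect f = begin-equality
      Σχ f  ≈⟨ Σχ-∷ f ⟩
      Σχ (f ∘ (0F ∷_)) + (Σχ (f ∘ (1F ∷_)) + (Σχ (f ∘ (2F ∷_)) + 0#))
        ≈⟨ +-congˡ (+-congˡ (+-identityʳ _)) ⟩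
      Σχ (f ∘ (0F ∷_)) + (Σχ (f ∘ (1F ∷_)) + Σχ (f ∘ (2F ∷_)))
        ≈⟨ trans (∑-+ (colourings n)) (+-congˡ (∑-+ (colourings n))) ⟨
      Σχ (λ χ → fibre zero f (0F ∷ χ))  ∎
  Σχ-fibre-cong (suc u) {f} {g} f≈g = trans (Σχ-∷ f)
    (trans (+-cong (tail 0F) (+-cong (tail 1F) (+-congʳ (tail 2F)))) (sym (Σχ-∷ g)))
    where
    tail : ∀ i → Σχ (f ∘ (i ∷_)) ≈ Σχ (g ∘ (i ∷_))
    tail i = Σχ-fibre-cong u λ χ → f≈g (i ∷ χ)

  -- Exchanging colours 1 and 2 permutes the colourings: at the head two summands trade places, and
  -- the tail follows by induction.
  Σχ-swap : ∀ {n} (f : Colouring n → Carrier) → Σχ f ≈ Σχ (f ∘ Vec.map swap)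
  Σχ-swap {zero}  f = refl
  Σχ-swap {suc n} f = begin-equality
    Σχ f  ≈⟨ Σχ-∷ f ⟩
    Σχ (f ∘ (0F ∷_)) + (Σχ (f ∘ (1F ∷_)) + (Σχ (f ∘ (2F ∷_)) + 0#))
      ≈⟨ solve 3 (λ a b c → a :+ (b :+ (c :+ con 0)) := a :+ (c :+ (b :+ con 0))) refl _ _ _ ⟩
    Σχ (f ∘ (0F ∷_)) + (Σχ (f ∘ (2F ∷_)) + (Σχ (f ∘ (1F ∷_)) + 0#))
      ≈⟨ +-cong (tail 0F) (+-cong (tail 2F) (+-congʳ (tail 1F))) ⟩
    Σχ (λ χ → f (0F ∷ Vec.map swap χ)) + (Σχ (λ χ → f (2F ∷ Vec.map swap χ)) + (Σχ (λ χ → f (1F ∷ Vec.map swap χ)) + 0#))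
      ≈⟨ Σχ-∷ (f ∘ Vec.map swap) ⟨
    Σχ (f ∘ Vec.map swap)  ∎
    where
    tail : ∀ i → Σχ (f ∘ (i ∷_)) ≈ Σχ (λ χ → f (i ∷ Vec.map swap χ))
    tail i = Σχ-swap (f ∘ (i ∷_))

  -- The Widom–Rowlinson model

  module Model (G : Graph) (z : Carrier) (0<z : 0# < z) where
    open Graph G
    open Powers z 0<z
    module WR = WidomRowlinson F

    V : List Vertex
    V = List.allFin order

    Config : Set
    Config = Colouring order

    Free : Fin 3 → Vertex → Config → Set
    Free i u χ = ∀ x → u ~ x → lookup χ x ≢ i

    free? : ∀ i u χ → Dec (Free i u χ)
    free? i u χ = Finₚ.all? λ x → (u ~? x) →-dec ¬? (lookup χ x ≟ i)

    isWR? : ∀ χ → Dec (IsWidomRowlinson G χ)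
    isWR? = isWidomRowlinson? G

    -- The weight extended by zero to colourings that are not Widom-Rowlinson, so that sums run over
    -- all colourings and split into fibres.
    w : Config → Carrier
    w χ = ind (isWR? χ) * WR.weight G z χ

    0⊑w : ∀ χ → 0# ⊑ w χ
    0⊑w χ = 0⊑* (0⊑ind (isWR? χ)) (inj₁ (^-pos (X 1F χ ℕ.+ X 2F χ) 0<z))

    -- The expectation multiplied by the partition function; working with it postpones all division
    -- to the end.
    ⟪_⟫ : (Config → Carrier) → Carrier
    ⟪ f ⟫ = Σχ (λ χ → w χ * f χ)

    ⟪⟫-cong : ∀ {f g} → (∀ χ → f χ ≈ g χ) → ⟪ f ⟫ ≈ ⟪ g ⟫
    ⟪⟫-cong f≈g = ∑-cong (colourings order) (λ χ → *-congˡ (f≈g χ))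

    ⟪⟫-mono : ∀ {f g} → (∀ χ → f χ ⊑ g χ) → ⟪ f ⟫ ⊑ ⟪ g ⟫
    ⟪⟫-mono f⊑g = ∑-mono (colourings order) (λ χ → *-monoʳ-⊑ (0⊑w χ) (f⊑g χ))

    ⟪⟫-+ : ∀ f g → ⟪ (λ χ → f χ + g χ) ⟫ ≈ ⟪ f ⟫ + ⟪ g ⟫
    ⟪⟫-+ f g = trans (∑-cong (colourings order) (λ χ → distribˡ (w χ) (f χ) (g χ)))
                     (∑-+ (colourings order))

    *-⟪⟫ : ∀ k f → k * ⟪ f ⟫ ≈ ⟪ (λ χ → k * f χ) ⟫
    *-⟪⟫ k f = trans (*-∑ k (colourings order)) (∑-cong (colourings order)
      (λ χ → solve 3 (λ k w f → k :* (w :* f) := w :* (k :* f)) refl k (w χ) (f χ)))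

    ⟪⟫-∑ : ∀ {a} {A : Set a} (xs : List A) (f : A → Config → Carrier) →
           ⟪ (λ χ → ∑ xs (λ x → f x χ)) ⟫ ≈ ∑ xs (λ x → ⟪ f x ⟫)
    ⟪⟫-∑ xs f = trans (∑-cong (colourings order) (λ χ → *-∑ (w χ) xs))
                      (∑-comm (colourings order) xs)

    ⟪⟫-cong-WR : ∀ {f g} → (∀ χ → IsWidomRowlinson G χ → f χ ≈ g χ) → ⟪ f ⟫ ≈ ⟪ g ⟫
    ⟪⟫-cong-WR {f} {g} f≈g = ∑-cong (colourings order) λ χ →
      trans (*-assoc _ _ (f χ))
        (trans (ind-*-cong (isWR? χ) (λ wr → *-congˡ (f≈g χ wr))) (sym (*-assoc _ _ (g χ))))

    ⟪⟫-0 : ∀ {f} → (∀ χ → IsWidomRowlinson G χ → f χ ≈ 0#) → ⟪ f ⟫ ≈ 0#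
    ⟪⟫-0 f≈0 = trans (⟪⟫-cong-WR {g = λ _ → 0#} f≈0)
      (trans (∑-cong (colourings order) (λ χ → zeroʳ (w χ))) (∑-0 (colourings order)))

    -- Recolouring a vertex from 0 to 1.

    module _ (u : Vertex) (χ : Config) (χu≡0 : lookup χ u ≡ 0F) where

      two-recolour : ∀ x → lookup (χ [ u ]≔ 1F) x ≡ 2F → lookup χ x ≡ 2F
      two-recolour x eq with x ≟ u
      ... | yes ≡.refl with () ← ≡.trans (≡.sym eq) (Vecₚ.lookup∘update u χ 1F)
      ... | no x≢u = ≡.trans (≡.sym (Vecₚ.lookup∘update′ x≢u χ 1F)) eq

      two-recolour⁻¹ : ∀ x → lookup χ x ≡ 2F → lookup (χ [ u ]≔ 1F) x ≡ 2F
      two-recolour⁻¹ x eq with x ≟ u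
      ... | yes ≡.refl with () ← ≡.trans (≡.sym eq) χu≡0
      ... | no x≢u = ≡.trans (Vecₚ.lookup∘update′ x≢u χ 1F) eq

      WR-recolour : IsWidomRowlinson G (χ [ u ]≔ 1F) → Free 2F u χ × IsWidomRowlinson G χ
      WR-recolour wr =
        (λ x u~x χx≡2 → wr u x u~x (Vecₚ.lookup∘update u χ 1F , two-recolour⁻¹ x χx≡2)) ,
        (λ a b a~b (χa≡1 , χb≡2) → wr a b a~b (one⁻¹ a χa≡1 , two-recolour⁻¹ b χb≡2))
        where
        one⁻¹ : ∀ a → lookup χ a ≡ 1F → lookup (χ [ u ]≔ 1F) a ≡ 1F
        one⁻¹ a eq with a ≟ u
        ... | yes ≡.refl with () ← ≡.trans (≡.sym eq) χu≡0
        ... | no a≢u = ≡.trans (Vecₚ.lookup∘update′ a≢u χ 1F) eq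

      WR-recolour⁻¹ : Free 2F u χ × IsWidomRowlinson G χ → IsWidomRowlinson G (χ [ u ]≔ 1F)
      WR-recolour⁻¹ (free , wr) a b a~b (χa≡1 , χb≡2) with a ≟ u
      ... | yes ≡.refl = free b a~b (two-recolour b χb≡2)
      ... | no a≢u     = wr a b a~b
        (≡.trans (≡.sym (Vecₚ.lookup∘update′ a≢u χ 1F)) χa≡1 , two-recolour b χb≡2)

      -- The recolouring preserves validity exactly when no neighbour of `u` has colour 2, and it
      -- adds one coloured vertex, hence one factor `z`.
      w-recolour : w (χ [ u ]≔ 1F) ≈ z * (ind (free? 2F u χ) * w χ)
      w-recolour = begin-equality
        ind (isWR? (χ [ u ]≔ 1F)) * z ^ (X 1F (χ [ u ]≔ 1F) ℕ.+ X 2F (χ [ u ]≔ 1F))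
          ≈⟨ *-cong (trans (ind-cong (isWR? (χ [ u ]≔ 1F)) (free? 2F u χ ×-dec isWR? χ) WR-recolour WR-recolour⁻¹)
                           (ind-× (free? 2F u χ) (isWR? χ)))
               (reflexive (≡.cong₂ (λ a b → z ^ (a ℕ.+ b))
                 (X-recolour-≡ 1F u χ (λ ()) χu≡0) (X-recolour-≢ 2F 1F u χ (λ ()) (λ ()) χu≡0))) ⟩
        ind (free? 2F u χ) * ind (isWR? χ) * (z * z ^ (X 1F χ ℕ.+ X 2F χ))
          ≈⟨ solve 4 (λ f i z k → f :* i :* (z :* k) := z :* (f :* (i :* k))) refl _ _ z _ ⟩
        z * (ind (free? 2F u χ) * w χ) ∎

      free₂-recolour : ∀ x → ind (free? 2F x (χ [ u ]≔ 1F)) ≈ ind (free? 2F x χ)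
      free₂-recolour x = ind-cong (free? 2F x (χ [ u ]≔ 1F)) (free? 2F x χ)
        (λ free b x~b → free b x~b ∘ two-recolour⁻¹ b) (λ free b x~b → free b x~b ∘ two-recolour b)

    -- The symmetry between colours 1 and 2.

    WR-swap : ∀ χ → IsWidomRowlinson G χ → IsWidomRowlinson G (Vec.map swap χ)
    WR-swap χ wr a b a~b (χa≡1 , χb≡2) = wr b a (~-sym a~b) (lookup-swap χ b χb≡2 , lookup-swap χ a χa≡1)

    WR-swap⁻¹ : ∀ χ → IsWidomRowlinson G (Vec.map swap χ) → IsWidomRowlinson G χ
    WR-swap⁻¹ χ wr a b a~b (χa≡1 , χb≡2) = wr b a (~-sym a~b) (lookup-swap⁻¹ χ b χb≡2 , lookup-swap⁻¹ χ a χa≡1)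

    w-swap : ∀ χ → w (Vec.map swap χ) ≈ w χ
    w-swap χ = *-cong (ind-cong (isWR? (Vec.map swap χ)) (isWR? χ) (WR-swap⁻¹ χ) (WR-swap χ))
      (reflexive (≡.cong (z ^_) (≡.trans (≡.cong₂ ℕ._+_ (X₁-swap χ) (X₂-swap χ)) (ℕₚ.+-comm (X 2F χ) (X 1F χ)))))

    ⟪⟫-swap : ∀ {f g} → (∀ χ → f (Vec.map swap χ) ≈ g χ) → ⟪ f ⟫ ≈ ⟪ g ⟫
    ⟪⟫-swap {f} f≈g = trans (Σχ-swap (λ χ → w χ * f χ))
      (∑-cong (colourings order) (λ χ → *-cong (w-swap χ) (f≈g χ)))

    free-swap : ∀ i v χ → ind (free? i v (Vec.map swap χ)) ≈ ind (free? (swap i) v χ)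
    free-swap i v χ = ind-cong (free? i v (Vec.map swap χ)) (free? (swap i) v χ)
      (λ free x v~x → free x v~x ∘ lookup-swap⁻¹ χ x) (λ free x v~x → free x v~x ∘ lookup-swap χ x)

    coloured-swap : ∀ i (v : Vertex) (χ : Config) → ind (lookup (Vec.map swap χ) v ≟ i) ≈ ind (lookup χ v ≟ swap i)
    coloured-swap i v χ = ind-cong (lookup (Vec.map swap χ) v ≟ i) (lookup χ v ≟ swap i)
      (lookup-swap χ v) (lookup-swap⁻¹ χ v)

    -- Colour 1 at a single vertex.

    coloured : Fin 3 → Vertex → Config → Carrier
    coloured i v χ = ind (lookup χ v ≟ i)

    free blocked : Fin 3 → Vertex → Config → Carrier
    free i v χ    = ind (free? i v χ)
    blocked i v χ = ind (¬? (free? i v χ))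

    -- Given the vertices coloured 2, u can be switched between 0 and 1 at will.
    Available : Vertex → Config → Set
    Available u χ = lookup χ u ≢ 2F × Free 2F u χ

    available? : ∀ u χ → Dec (Available u χ)
    available? u χ = ¬? (lookup χ u ≟ 2F) ×-dec free? 2F u χ

    available : Vertex → Config → Carrier
    available u χ = ind (available? u χ)

    coloured-≡ : ∀ i v χ → lookup χ v ≡ i → coloured i v χ ≈ 1#
    coloured-≡ i v χ = ind-yes (lookup χ v ≟ i)

    coloured-≢ : ∀ i j v χ → lookup χ v ≡ j → j ≢ i → coloured i v χ ≈ 0#
    coloured-≢ i j v χ χv≡j j≢i = ind-no (lookup χ v ≟ i) (j≢i ∘ ≡.trans (≡.sym χv≡j))

    coloured-updated : ∀ i v χ → coloured i v (χ [ v ]≔ i) ≈ 1#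
    coloured-updated i v χ = coloured-≡ i v (χ [ v ]≔ i) (Vecₚ.lookup∘update v χ i)

    coloured-updated′ : ∀ i j v χ → j ≢ i → coloured i v (χ [ v ]≔ j) ≈ 0#
    coloured-updated′ i j v χ = coloured-≢ i j v (χ [ v ]≔ j) (Vecₚ.lookup∘update v χ j)

    available-≢2 : ∀ u χ → lookup χ u ≢ 2F → available u χ ≈ free 2F u χ
    available-≢2 u χ χu≢2 = ind-cong (available? u χ) (free? 2F u χ) proj₂ (χu≢2 ,_)

    available-≡2 : ∀ u χ → lookup χ u ≡ 2F → available u χ ≈ 0#
    available-≡2 u χ χu≡2 = ind-no (available? u χ) (λ av → proj₁ av χu≡2)

    -- Satisfied by every function of the set of vertices coloured 2 and of the colours at vertices
    -- other than `u`.
    Invariant : Vertex → (Config → Carrier) → Set _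
    Invariant u k = ∀ χ → lookup χ u ≡ 0F → k (χ [ u ]≔ 1F) ≈ k χ

    module _ (u : Vertex) {k : Config → Carrier} (inv : Invariant u k) where

      -- In each fibre only the colouring with `u` coloured 1 counts on the left and only the one
      -- with `u` coloured 0 on the right; `w-recolour` relates their weights.
      ⟪coloured₁⟫ : ⟪ (λ χ → coloured 1F u χ * k χ) ⟫ ≈ z * ⟪ (λ χ → coloured 0F u χ * (free 2F u χ * k χ)) ⟫
      ⟪coloured₁⟫ = trans (Σχ-fibre-cong u eq) (sym (*-⟪⟫ z _))
        where
        eq : ∀ χ → lookup χ u ≡ 0F → fibre u (λ χ → w χ * (coloured 1F u χ * k χ)) χ
               ≈ fibre u (λ χ → w χ * (z * (coloured 0F u χ * (free 2F u χ * k χ)))) χ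
        eq χ χu≡0 = begin-equality
          w χ * (coloured 1F u χ * k χ) + (w χ₁ * (coloured 1F u χ₁ * k χ₁) + w χ₂ * (coloured 1F u χ₂ * k χ₂))
            ≈⟨ +-cong (*-congˡ (*-congʳ (coloured-≢ 1F 0F u χ χu≡0 λ ())))
                 (+-cong (*-cong (w-recolour u χ χu≡0) (*-cong (coloured-updated 1F u χ) (inv χ χu≡0)))
                   (*-congˡ (*-congʳ (coloured-updated′ 1F 2F u χ λ ())))) ⟩
          w χ * (0# * k χ) + (z * (free 2F u χ * w χ) * (1# * k χ) + w χ₂ * (0# * k χ₂))
            ≈⟨ solve 9 (λ w₀ w₁ w₂ z f k₀ k₂ l₁ l₂ →
                   w₀ :* (con 0 :* k₀) :+ (z :* (f :* w₀) :* (con 1 :* k₀) :+ w₂ :* (con 0 :* k₂))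
                := w₀ :* (z :* (con 1 :* (f :* k₀))) :+ (w₁ :* (z :* (con 0 :* l₁)) :+ w₂ :* (z :* (con 0 :* l₂))))
                 refl (w χ) (w χ₁) (w χ₂) z (free 2F u χ) (k χ) (k χ₂) (free 2F u χ₁ * k χ₁) (free 2F u χ₂ * k χ₂) ⟩
          w χ * (z * (1# * (free 2F u χ * k χ)))
            + (w χ₁ * (z * (0# * (free 2F u χ₁ * k χ₁))) + w χ₂ * (z * (0# * (free 2F u χ₂ * k χ₂))))
            ≈⟨ +-cong (*-congˡ (*-congˡ (*-congʳ (coloured-≡ 0F u χ χu≡0))))
                 (+-cong (*-congˡ (*-congˡ (*-congʳ (coloured-updated′ 0F 1F u χ λ ()))))
                         (*-congˡ (*-congˡ (*-congʳ (coloured-updated′ 0F 2F u χ λ ()))))) ⟨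
          fibre u (λ χ → w χ * (z * (coloured 0F u χ * (free 2F u χ * k χ)))) χ  ∎
          where
          χ₁ = χ [ u ]≔ 1F
          χ₂ = χ [ u ]≔ 2F

      -- Where `u` is available its colours 0 and 1 have relative weights 1 and `z`, so colour 1
      -- takes the fraction z / y of their total.
      y*⟪coloured₁⟫ : y * ⟪ (λ χ → coloured 1F u χ * k χ) ⟫ ≈ z * ⟪ (λ χ → available u χ * k χ) ⟫
      y*⟪coloured₁⟫ = trans (*-⟪⟫ y _) (trans (Σχ-fibre-cong u eq) (sym (*-⟪⟫ z _)))
        where
        eq : ∀ χ → lookup χ u ≡ 0F → fibre u (λ χ → w χ * (y * (coloured 1F u χ * k χ))) χ
               ≈ fibre u (λ χ → w χ * (z * (available u χ * k χ))) χ
        eq χ χu≡0 = begin-equality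
          fibre u (λ χ → w χ * (y * (coloured 1F u χ * k χ))) χ
            ≈⟨ +-cong (*-congˡ (*-congˡ (*-congʳ (coloured-≢ 1F 0F u χ χu≡0 λ ()))))
                 (+-cong (*-cong (w-recolour u χ χu≡0) (*-congˡ (*-cong (coloured-updated 1F u χ) (inv χ χu≡0))))
                   (*-congˡ (*-congˡ (*-congʳ (coloured-updated′ 1F 2F u χ λ ()))))) ⟩
          w χ * (y * (0# * k χ)) + (z * (f * w χ) * (y * (1# * k χ)) + w χ₂ * (y * (0# * k χ₂)))
            ≈⟨ solve 6 (λ w₀ w₂ z f k₀ k₂ →
                   w₀ :* ((con 1 :+ z) :* (con 0 :* k₀)) :+ (z :* (f :* w₀) :* ((con 1 :+ z) :* (con 1 :* k₀)) :+ w₂ :* ((con 1 :+ z) :* (con 0 :* k₂)))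
                := w₀ :* (z :* (f :* k₀)) :+ (z :* w₀ :* (z :* k₀) :* f :+ w₂ :* (z :* (con 0 :* k₂))))
                 refl (w χ) (w χ₂) z f (k χ) (k χ₂) ⟩
          w χ * (z * (f * k χ)) + (z * w χ * (z * k χ) * f + w χ₂ * (z * (0# * k χ₂)))
            -- The weight of `χ₁` already contains `f`; idempotence supplies the second copy, which
            -- becomes the indicator of availability at `χ₁`.
            ≈⟨ +-congˡ (+-congʳ (trans (*-congˡ (sym (ind-idem (free? 2F u χ))))
                 (solve 4 (λ w₀ z f k₀ → z :* w₀ :* (z :* k₀) :* (f :* f) := z :* (f :* w₀) :* (z :* (f :* k₀)))
                   refl (w χ) z f (k χ)))) ⟩
          w χ * (z * (f * k χ)) + (z * (f * w χ) * (z * (f * k χ)) + w χ₂ * (z * (0# * k χ₂)))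
            ≈⟨ +-cong (*-congˡ (*-congˡ (*-congʳ (available-≢2 u χ χu≢2))))
                 (+-cong (*-cong (w-recolour u χ χu≡0)
                           (*-congˡ (*-cong (trans (available-≢2 u χ₁ χ₁u≢2) (free₂-recolour u χ χu≡0 u)) (inv χ χu≡0))))
                         (*-congˡ (*-congˡ (*-congʳ (available-≡2 u χ₂ (Vecₚ.lookup∘update u χ 2F)))))) ⟨
          fibre u (λ χ → w χ * (z * (available u χ * k χ))) χ  ∎
          where
          χ₁ = χ [ u ]≔ 1F
          χ₂ = χ [ u ]≔ 2F
          f = free 2F u χ
          χu≢2 : lookup χ u ≢ 2F
          χu≢2 eq with () ← ≡.trans (≡.sym eq) χu≡0
          χ₁u≢2 : lookup χ₁ u ≢ 2F
          χ₁u≢2 eq with () ← ≡.trans (≡.sym eq) (Vecₚ.lookup∘update u χ 1F)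

      -- The colouring with `u` coloured 1 is merged into the one with `u` coloured 0, whose weight
      -- thereby grows by the factor 1 + z if `u` is available and is unchanged otherwise.
      ⟪⟫-uncolour : ⟪ k ⟫ ≈ ⟪ (λ χ → ind (¬? (lookup χ u ≟ 1F)) * ((1# + z * available u χ) * k χ)) ⟫
      ⟪⟫-uncolour = Σχ-fibre-cong u eq
        where
        n1 : Config → Carrier
        n1 χ = ind (¬? (lookup χ u ≟ 1F))
        eq : ∀ χ → lookup χ u ≡ 0F → fibre u (λ χ → w χ * k χ) χ
               ≈ fibre u (λ χ → w χ * (n1 χ * ((1# + z * available u χ) * k χ))) χ
        eq χ χu≡0 = begin-equality
          w χ * k χ + (w χ₁ * k χ₁ + w χ₂ * k χ₂)
            ≈⟨ +-congˡ (+-congʳ (*-cong (w-recolour u χ χu≡0) (inv χ χu≡0))) ⟩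
          w χ * k χ + (z * (f * w χ) * k χ + w χ₂ * k χ₂)
            ≈⟨ solve 7 (λ w₀ w₁ w₂ z f k₀ k₂ →
                   w₀ :* k₀ :+ (z :* (f :* w₀) :* k₀ :+ w₂ :* k₂)
                := w₀ :* (con 1 :* ((con 1 :+ z :* f) :* k₀)) :+ (con 0 :* w₁ :+ w₂ :* (con 1 :* ((con 1 :+ z :* con 0) :* k₂))))
                 refl (w χ) (w χ₁ * ((1# + z * available u χ₁) * k χ₁)) (w χ₂) z f (k χ) (k χ₂) ⟩
          w χ * (1# * ((1# + z * f) * k χ)) + (0# * (w χ₁ * ((1# + z * available u χ₁) * k χ₁)) + w χ₂ * (1# * ((1# + z * 0#) * k χ₂)))
            ≈⟨ +-cong (*-congˡ (*-cong n1χ≈1 (*-congʳ (+-congˡ (*-congˡ (available-≢2 u χ χu≢2))))))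
                 (+-cong (trans (*-congˡ (*-congʳ n1χ₁≈0)) (solve 2 (λ a b → a :* (con 0 :* b) := con 0 :* (a :* b)) refl (w χ₁) _))
                         (*-congˡ (*-cong n1χ₂≈1 (*-congʳ (+-congˡ (*-congˡ (available-≡2 u χ₂ (Vecₚ.lookup∘update u χ 2F)))))))) ⟨
          fibre u (λ χ → w χ * (n1 χ * ((1# + z * available u χ) * k χ))) χ  ∎
          where
          χ₁ = χ [ u ]≔ 1F
          χ₂ = χ [ u ]≔ 2F
          f = free 2F u χ
          χu≢2 : lookup χ u ≢ 2F
          χu≢2 eq with () ← ≡.trans (≡.sym eq) χu≡0
          n1χ≈1 : n1 χ ≈ 1#
          n1χ≈1 = ind-yes (¬? (lookup χ u ≟ 1F)) λ eq → case ≡.trans (≡.sym eq) χu≡0 of λ ()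
          n1χ₁≈0 : n1 χ₁ ≈ 0#
          n1χ₁≈0 = ind-no (¬? (lookup χ₁ u ≟ 1F)) λ neq → neq (Vecₚ.lookup∘update u χ 1F)
          n1χ₂≈1 : n1 χ₂ ≈ 1#
          n1χ₂≈1 = ind-yes (¬? (lookup χ₂ u ≟ 1F)) λ eq → case ≡.trans (≡.sym eq) (Vecₚ.lookup∘update u χ 2F) of λ ()

    -- Removing colour 1 from a list of vertices.

    #available : List Vertex → Config → ℕ
    #available us χ = length (filter (λ u → available? u χ) us)

    NoneColoured₁ : List Vertex → Config → Set
    NoneColoured₁ us χ = All (λ u → lookup χ u ≢ 1F) us

    noneColoured₁? : ∀ us χ → Dec (NoneColoured₁ us χ)
    noneColoured₁? us χ = All.all? (λ u → ¬? (lookup χ u ≟ 1F)) us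

    #available-recolour : ∀ u us χ → lookup χ u ≡ 0F → #available us (χ [ u ]≔ 1F) ≡ #available us χ
    #available-recolour u us χ χu≡0 = ≡.cong length (Listₚ.filter-≐ (λ x → available? x (χ [ u ]≔ 1F)) (λ x → available? x χ)
      ( (λ {x} (≢2 , free) → ≢2 ∘ two-recolour⁻¹ u χ χu≡0 x , λ b x~b → free b x~b ∘ two-recolour⁻¹ u χ χu≡0 b)
      , (λ {x} (≢2 , free) → ≢2 ∘ two-recolour u χ χu≡0 x , λ b x~b → free b x~b ∘ two-recolour u χ χu≡0 b)) us)

    noneColoured₁-recolour : ∀ u us → All (u ≢_) us → Invariant u (λ χ → ind (noneColoured₁? us χ))
    noneColoured₁-recolour u us u∉us χ _ = ind-cong (noneColoured₁? us (χ [ u ]≔ 1F)) (noneColoured₁? us χ)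
      (λ none → All.zipWith (λ (u≢x , χx≢1) → χx≢1 ∘ ≡.trans (Vecₚ.lookup∘update′ (u≢x ∘ ≡.sym) χ 1F)) (u∉us , none))
      (λ none → All.zipWith (λ (u≢x , χx≢1) → χx≢1 ∘ ≡.trans (≡.sym (Vecₚ.lookup∘update′ (u≢x ∘ ≡.sym) χ 1F))) (u∉us , none))

    y^#available-∷ : ∀ u us χ → y ^ #available (u ∷ us) χ ≈ (1# + z * available u χ) * y ^ #available us χ
    y^#available-∷ u us χ with does (available? u χ)
    ... | true  = *-congʳ (+-congˡ (sym (*-identityʳ z)))
    ... | false = sym (trans (*-congʳ (trans (+-congˡ (zeroʳ z)) (+-identityʳ 1#))) (*-identityˡ _))

    noneColoured₁-∷ : ∀ u us χ → ind (noneColoured₁? (u ∷ us) χ) ≈ ind (¬? (lookup χ u ≟ 1F)) * ind (noneColoured₁? us χ)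
    noneColoured₁-∷ u us χ = trans
      (ind-cong (noneColoured₁? (u ∷ us) χ) (¬? (lookup χ u ≟ 1F) ×-dec noneColoured₁? us χ)
        (λ { (p ∷ ps) → p , ps }) (λ (p , ps) → p ∷ ps))
      (ind-× (¬? (lookup χ u ≟ 1F)) (noneColoured₁? us χ))

    -- Availability depends only on the vertices coloured 2, so the available vertices choose
    -- between 0 and 1 independently, even if adjacent, and each contributes a factor `y`.
    -- Uniqueness ensures that uncolouring `u` does not disturb the condition on the remaining
    -- vertices.
    ⟪⟫-uncolour* : ∀ {us} {k} → Unique us → All (λ u → Invariant u k) us →
      ⟪ k ⟫ ≈ ⟪ (λ χ → ind (noneColoured₁? us χ) * (y ^ #available us χ * k χ)) ⟫
    ⟪⟫-uncolour* {[]}     {k} []             []           = ⟪⟫-cong λ χ → sym (trans (*-identityˡ _) (*-identityˡ _))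
    ⟪⟫-uncolour* {u ∷ us} {k} (u∉us ∷ uniq) (inv ∷ invs) = begin-equality
      ⟪ k ⟫   ≈⟨ ⟪⟫-uncolour* uniq invs ⟩
      ⟪ k′ ⟫  ≈⟨ ⟪⟫-uncolour u inv′ ⟩
      ⟪ (λ χ → ind (¬? (lookup χ u ≟ 1F)) * ((1# + z * available u χ) * k′ χ)) ⟫
        ≈⟨ ⟪⟫-cong (λ χ → trans
             (solve 5 (λ a b c d k → a :* (b :* (c :* (d :* k))) := a :* c :* (b :* d :* k)) refl _ _ _ _ (k χ))
             (sym (*-cong (noneColoured₁-∷ u us χ) (*-congʳ (y^#available-∷ u us χ))))) ⟩
      ⟪ (λ χ → ind (noneColoured₁? (u ∷ us) χ) * (y ^ #available (u ∷ us) χ * k χ)) ⟫ ∎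
      where
      k′ : Config → Carrier
      k′ χ = ind (noneColoured₁? us χ) * (y ^ #available us χ * k χ)
      inv′ : Invariant u k′
      inv′ χ χu≡0 = *-cong (noneColoured₁-recolour u us u∉us χ χu≡0)
        (*-cong (reflexive (≡.cong (y ^_) (#available-recolour u us χ χu≡0))) (inv χ χu≡0))

    -- The neighbourhood of a vertex.

    neighbours : Vertex → List Vertex
    neighbours v = filter (v ~?_) V

    -- The number of neighbours of `v` coloured 1, written as a sum over all vertices so that it can
    -- be exchanged with the sum over colourings.
    X₁ : Vertex → Config → Carrier
    X₁ v χ = ∑ V (λ u → ind (v ~? u) * coloured 1F u χ)

    neighbours-unique : ∀ v → Unique (neighbours v)
    neighbours-unique v = Uniqueₚ.filter⁺ (v ~?_) (Uniqueₚ.allFin⁺ order)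

    ∈-neighbours⁻ : ∀ {u v} → u ∈ neighbours v → v ~ u
    ∈-neighbours⁻ {v = v} u∈ = proj₂ (∈-filter⁻ (v ~?_) {xs = V} u∈)

    ∈-neighbours⁺ : ∀ {u v} → v ~ u → u ∈ neighbours v
    ∈-neighbours⁺ {u} {v} = ∈-filter⁺ (v ~?_) (∈-allFin u)

    length-neighbours : ∀ v → length (neighbours v) ≡ degree v
    length-neighbours v = ≡.sym (count-tabulate (v ~?_) id)

    #availableNbrs : Vertex → Config → ℕ
    #availableNbrs v = #available (neighbours v)

    fromℕ-#availableNbrs : ∀ v χ → fromℕ (#availableNbrs v χ) ≈ ∑ V (λ u → ind (v ~? u) * available u χ)
    fromℕ-#availableNbrs v χ = trans (fromℕ-length-filter (λ u → available? u χ) (neighbours v)) (∑-filter (v ~?_) V)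

    ⟪∑neighbours⟫ : ∀ v (g : Vertex → Config → Carrier) (h : Config → Carrier) →
      ⟪ (λ χ → ∑ V (λ u → ind (v ~? u) * g u χ) * h χ) ⟫ ≈ ∑ V (λ u → ind (v ~? u) * ⟪ (λ χ → g u χ * h χ) ⟫)
    ⟪∑neighbours⟫ v g h = begin-equality
      ⟪ (λ χ → ∑ V (λ u → ind (v ~? u) * g u χ) * h χ) ⟫
        ≈⟨ ⟪⟫-cong (λ χ → trans (∑-* (h χ) V) (∑-cong V (λ u → *-assoc (ind (v ~? u)) (g u χ) (h χ)))) ⟩
      ⟪ (λ χ → ∑ V (λ u → ind (v ~? u) * (g u χ * h χ))) ⟫
        ≈⟨ ⟪⟫-∑ V (λ u χ → ind (v ~? u) * (g u χ * h χ)) ⟩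
      ∑ V (λ u → ⟪ (λ χ → ind (v ~? u) * (g u χ * h χ)) ⟫)
        ≈⟨ ∑-cong V (λ u → *-⟪⟫ (ind (v ~? u)) (λ χ → g u χ * h χ)) ⟨
      ∑ V (λ u → ind (v ~? u) * ⟪ (λ χ → g u χ * h χ) ⟫) ∎

    -- The local bound on the neighbours coloured 1.

    module _ (v : Vertex) {h : Config → Carrier} (inv : ∀ u → v ~ u → Invariant u h) where

      y*⟪X₁⟫ : y * ⟪ (λ χ → X₁ v χ * h χ) ⟫ ≈ z * ⟪ (λ χ → fromℕ (#availableNbrs v χ) * h χ) ⟫
      y*⟪X₁⟫ = begin-equality
        y * ⟪ (λ χ → X₁ v χ * h χ) ⟫
          ≈⟨ *-congˡ (⟪∑neighbours⟫ v (coloured 1F) h) ⟩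
        y * ∑ V (λ u → ind (v ~? u) * ⟪ (λ χ → coloured 1F u χ * h χ) ⟫)
          ≈⟨ *-∑ y V ⟩
        ∑ V (λ u → y * (ind (v ~? u) * ⟪ (λ χ → coloured 1F u χ * h χ) ⟫))
          ≈⟨ ∑-cong V (λ u → trans (x*yz≈y*xz y (ind (v ~? u)) _)
               (trans (ind-*-cong (v ~? u) (λ v~u → y*⟪coloured₁⟫ u (inv u v~u))) (x*yz≈y*xz (ind (v ~? u)) z _))) ⟩
        ∑ V (λ u → z * (ind (v ~? u) * ⟪ (λ χ → available u χ * h χ) ⟫))
          ≈⟨ *-∑ z V ⟨
        z * ∑ V (λ u → ind (v ~? u) * ⟪ (λ χ → available u χ * h χ) ⟫)
          ≈⟨ *-congˡ (⟪∑neighbours⟫ v available h) ⟨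
        z * ⟪ (λ χ → ∑ V (λ u → ind (v ~? u) * available u χ) * h χ) ⟫
          ≈⟨ *-congˡ (⟪⟫-cong (λ χ → *-congʳ (fromℕ-#availableNbrs v χ))) ⟨
        z * ⟪ (λ χ → fromℕ (#availableNbrs v χ) * h χ) ⟫ ∎

      ⟪⟫-uncolour-neighbours : ∀ {k} → (∀ u → v ~ u → Invariant u k) →
        ⟪ k ⟫ ≈ ⟪ (λ χ → free 1F v χ * (y ^ #availableNbrs v χ * k χ)) ⟫
      ⟪⟫-uncolour-neighbours {k} inv = trans
        (⟪⟫-uncolour* (neighbours-unique v) (All.tabulate λ u∈ → inv _ (∈-neighbours⁻ u∈)))
        (⟪⟫-cong λ χ → *-congʳ (ind-cong (noneColoured₁? (neighbours v) χ) (free? 1F v χ)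
          (λ none u v~u → All.lookup none (∈-neighbours⁺ v~u))
          (λ free → All.tabulate λ u∈ → free _ (∈-neighbours⁻ u∈))))

      -- The subsets of `a` available neighbours have total weight y ^ a, and the empty one, of
      -- weight 1, is the only one that leaves `v` without a neighbour coloured 1. Subtraction is
      -- replaced by cancelling the empty case from both sides.
      ⟪blocked₁⟫ : ⟪ (λ χ → blocked 1F v χ * h χ) ⟫ ≈ ⟪ (λ χ → free 1F v χ * (pow-1 (#availableNbrs v χ) * h χ)) ⟫
      ⟪blocked₁⟫ = +-cancelˡ ⟪ (λ χ → free 1F v χ * h χ) ⟫ _ _ (begin-equality
        ⟪ (λ χ → free 1F v χ * h χ) ⟫ + ⟪ (λ χ → blocked 1F v χ * h χ) ⟫
          ≈⟨ ⟪⟫-+ (λ χ → free 1F v χ * h χ) (λ χ → blocked 1F v χ * h χ) ⟨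
        ⟪ (λ χ → free 1F v χ * h χ + blocked 1F v χ * h χ) ⟫
          ≈⟨ ⟪⟫-cong (λ χ → trans (sym (distribʳ (h χ) _ _)) (trans (*-congʳ (ind-+-¬ (free? 1F v χ))) (*-identityˡ (h χ)))) ⟩
        ⟪ h ⟫
          ≈⟨ ⟪⟫-uncolour-neighbours inv ⟩
        ⟪ (λ χ → free 1F v χ * (y ^ #availableNbrs v χ * h χ)) ⟫
          ≈⟨ ⟪⟫-cong (λ χ → trans (*-congˡ (*-congʳ (y^n≈1+pow-1 (#availableNbrs v χ))))
               (solve 3 (λ f p h → f :* ((con 1 :+ p) :* h) := f :* h :+ f :* (p :* h)) refl _ (pow-1 (#availableNbrs v χ)) (h χ))) ⟩
        ⟪ (λ χ → free 1F v χ * h χ + free 1F v χ * (pow-1 (#availableNbrs v χ) * h χ)) ⟫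
          ≈⟨ ⟪⟫-+ (λ χ → free 1F v χ * h χ) (λ χ → free 1F v χ * (pow-1 (#availableNbrs v χ) * h χ)) ⟩
        ⟪ (λ χ → free 1F v χ * h χ) ⟫ + ⟪ (λ χ → free 1F v χ * (pow-1 (#availableNbrs v χ) * h χ)) ⟫ ∎)

      module _ (d : ℕ) where

        private
          s q : Carrier
          s = slope d
          q = y ^ d

        -- This and the next identity bring the two sides of the local bound to one form: a common
        -- nonnegative factor times a quantity that depends only on the number of available
        -- neighbours.
        slope*y*⟪X₁⟫ : s * (y * ⟪ (λ χ → X₁ v χ * h χ) ⟫)
          ≈ ⟪ (λ χ → z * free 1F v χ * h χ * (s * (fromℕ (#availableNbrs v χ) * y ^ #availableNbrs v χ))) ⟫
        slope*y*⟪X₁⟫ = begin-equality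
          s * (y * ⟪ (λ χ → X₁ v χ * h χ) ⟫)
            ≈⟨ *-congˡ y*⟪X₁⟫ ⟩
          s * (z * ⟪ (λ χ → fromℕ (#availableNbrs v χ) * h χ) ⟫)
            ≈⟨ *-assoc s z _ ⟨
          s * z * ⟪ (λ χ → fromℕ (#availableNbrs v χ) * h χ) ⟫
            ≈⟨ *-congˡ (⟪⟫-uncolour-neighbours (λ u v~u χ χu≡0 → *-cong
                 (reflexive (≡.cong fromℕ (#available-recolour u (neighbours v) χ χu≡0))) (inv u v~u χ χu≡0))) ⟩
          s * z * ⟪ (λ χ → free 1F v χ * (y ^ #availableNbrs v χ * (fromℕ (#availableNbrs v χ) * h χ))) ⟫
            ≈⟨ *-⟪⟫ (s * z) _ ⟩
          ⟪ (λ χ → s * z * (free 1F v χ * (y ^ #availableNbrs v χ * (fromℕ (#availableNbrs v χ) * h χ)))) ⟫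
            ≈⟨ ⟪⟫-cong (λ χ → solve 6 (λ s z f yᵃ a h → s :* z :* (f :* (yᵃ :* (a :* h))) := z :* f :* h :* (s :* (a :* yᵃ)))
                 refl s z _ _ _ _) ⟩
          ⟪ (λ χ → z * free 1F v χ * h χ * (s * (fromℕ (#availableNbrs v χ) * y ^ #availableNbrs v χ))) ⟫ ∎

        q*z*⟪blocked₁⟫ : q * z * ⟪ (λ χ → blocked 1F v χ * h χ) ⟫
          ≈ ⟪ (λ χ → z * free 1F v χ * h χ * (q * pow-1 (#availableNbrs v χ))) ⟫
        q*z*⟪blocked₁⟫ = begin-equality
          q * z * ⟪ (λ χ → blocked 1F v χ * h χ) ⟫
            ≈⟨ *-congˡ ⟪blocked₁⟫ ⟩
          q * z * ⟪ (λ χ → free 1F v χ * (pow-1 (#availableNbrs v χ) * h χ)) ⟫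
            ≈⟨ *-⟪⟫ (q * z) _ ⟩
          ⟪ (λ χ → q * z * (free 1F v χ * (pow-1 (#availableNbrs v χ) * h χ))) ⟫
            ≈⟨ ⟪⟫-cong (λ χ → solve 5 (λ q z f p h → q :* z :* (f :* (p :* h)) := z :* f :* h :* (q :* p)) refl q z _ _ _) ⟩
          ⟪ (λ χ → z * free 1F v χ * h χ * (q * pow-1 (#availableNbrs v χ))) ⟫ ∎

        -- Term by term this is `slope-⊑`, as at most `d` neighbours are available. For positive `d`
        -- it says that, under the weighting by `h`, the mean number of neighbours coloured 1 given
        -- at least one is at most (z / y) d / (1 - y ^ -d).
        local-⊑ : degree v ≡ d → (∀ χ → 0# ⊑ h χ) →
          s * (y * ⟪ (λ χ → X₁ v χ * h χ) ⟫) ⊑ q * z * ⟪ (λ χ → blocked 1F v χ * h χ) ⟫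
        local-⊑ deg≡d 0⊑h = begin
          s * (y * ⟪ (λ χ → X₁ v χ * h χ) ⟫)
            ≈⟨ slope*y*⟪X₁⟫ ⟩
          ⟪ (λ χ → z * free 1F v χ * h χ * (s * (fromℕ (#availableNbrs v χ) * y ^ #availableNbrs v χ))) ⟫
            ≤⟨ ⟪⟫-mono (λ χ → *-monoʳ-⊑ (0⊑* (0⊑* (inj₁ 0<z) (0⊑ind (free? 1F v χ))) (0⊑h χ)) (slope-⊑ (#≤d χ))) ⟩
          ⟪ (λ χ → z * free 1F v χ * h χ * (q * pow-1 (#availableNbrs v χ))) ⟫
            ≈⟨ q*z*⟪blocked₁⟫ ⟨
          q * z * ⟪ (λ χ → blocked 1F v χ * h χ) ⟫ ∎
          where
          #≤d : ∀ χ → #availableNbrs v χ ℕ.≤ d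
          #≤d χ = ℕₚ.≤-trans (Listₚ.length-filter (λ u → available? u χ) (neighbours v))
            (ℕₚ.≤-reflexive (≡.trans (length-neighbours v) deg≡d))

        -- Terms with `h χ` zero vanish on both sides; in the others all `d` neighbours are
        -- available, and `slope-≈` applies.
        local-≈ : (∀ χ → IsWidomRowlinson G χ → h χ ≈ 0# ⊎ #availableNbrs v χ ≡ d) →
          s * (y * ⟪ (λ χ → X₁ v χ * h χ) ⟫) ≈ q * z * ⟪ (λ χ → blocked 1F v χ * h χ) ⟫
        local-≈ full = trans slope*y*⟪X₁⟫ (trans (⟪⟫-cong-WR eq) (sym q*z*⟪blocked₁⟫))
          where
          eq : ∀ χ → IsWidomRowlinson G χ → z * free 1F v χ * h χ * (s * (fromℕ (#availableNbrs v χ) * y ^ #availableNbrs v χ))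
                                          ≈ z * free 1F v χ * h χ * (q * pow-1 (#availableNbrs v χ))
          eq χ wr with full χ wr
          ... | inj₁ h≈0 = trans (vanish _) (sym (vanish _))
            where
            vanish : ∀ t → z * free 1F v χ * h χ * t ≈ 0#
            vanish t = trans (*-congʳ (trans (*-congˡ h≈0) (zeroʳ _))) (zeroˡ t)
          ... | inj₂ ≡d rewrite ≡d = *-congˡ (slope-≈ d)

    -- The inequality at one vertex of a regular graph.

    module RegularModel (d : ℕ) (regular : Regular d G) where

      s q : Carrier
      s = slope d
      q = y ^ d

      0<q : 0# < q
      0<q = ^-pos d 0<y

      M W : Vertex → Carrier
      M v = ⟪ coloured 1F v ⟫
      W v = ⟪ coloured 0F v ⟫

      -- W v is the weight of the event that v has colour 0.  The suffixes ¬2, 1¬2 and 12 restrict it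
      -- by the colours occurring among the neighbours of v: not 2, 1 but not 2, both.
      -- N1¬2 and N12 are the weighted numbers of neighbours coloured 1.
      h₁ h₂ : Vertex → Config → Carrier
      h₁ v χ = coloured 0F v χ * free 2F v χ
      h₂ v χ = coloured 0F v χ * blocked 2F v χ

      W¬2 W1¬2 N1¬2 N12 W12 : Vertex → Carrier
      W¬2 v  = ⟪ h₁ v ⟫
      W1¬2 v = ⟪ (λ χ → blocked 1F v χ * h₁ v χ) ⟫
      W12 v  = ⟪ (λ χ → blocked 1F v χ * h₂ v χ) ⟫
      N1¬2 v = ⟪ (λ χ → X₁ v χ * h₁ v χ) ⟫
      N12 v  = ⟪ (λ χ → X₁ v χ * h₂ v χ) ⟫

      ~⇒≢ : ∀ {u v} → u ~ v → u ≢ v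
      ~⇒≢ u~v u≡v = ~-irrefl u≡v u~v

      coloured-recolour : ∀ i {u v} χ → v ≢ u → coloured i v (χ [ u ]≔ 1F) ≈ coloured i v χ
      coloured-recolour i {u} {v} χ v≢u = reflexive (≡.cong (λ j → ind (j ≟ i)) (Vecₚ.lookup∘update′ v≢u χ 1F))

      blocked₂-recolour : ∀ u v χ → lookup χ u ≡ 0F → blocked 2F v (χ [ u ]≔ 1F) ≈ blocked 2F v χ
      blocked₂-recolour u v χ χu≡0 = ind-cong (¬? (free? 2F v (χ [ u ]≔ 1F))) (¬? (free? 2F v χ))
        (λ ¬free free → ¬free λ b v~b → free b v~b ∘ two-recolour u χ χu≡0 b)
        (λ ¬free free → ¬free λ b v~b → free b v~b ∘ two-recolour⁻¹ u χ χu≡0 b)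

      h₁-invariant : ∀ v u → v ~ u → Invariant u (h₁ v)
      h₁-invariant v u v~u χ χu≡0 = *-cong (coloured-recolour 0F χ (~⇒≢ v~u)) (free₂-recolour u χ χu≡0 v)

      h₂-invariant : ∀ v u → v ~ u → Invariant u (h₂ v)
      h₂-invariant v u v~u χ χu≡0 = *-cong (coloured-recolour 0F χ (~⇒≢ v~u)) (blocked₂-recolour u v χ χu≡0)

      X₁-invariant : ∀ v → Invariant v (X₁ v)
      X₁-invariant v χ _ = ∑-cong V λ u → ind-*-cong (v ~? u) λ v~u →
        coloured-recolour 1F χ (~⇒≢ v~u ∘ ≡.sym)

      0⊑h₁ : ∀ v χ → 0# ⊑ h₁ v χ
      0⊑h₁ v χ = 0⊑* (0⊑ind (lookup χ v ≟ 0F)) (0⊑ind (free? 2F v χ))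

      0⊑h₂ : ∀ v χ → 0# ⊑ h₂ v χ
      0⊑h₂ v χ = 0⊑* (0⊑ind (lookup χ v ≟ 0F)) (0⊑ind (¬? (free? 2F v χ)))

      0⊑⟪⟫ : ∀ {f} → (∀ χ → 0# ⊑ f χ) → 0# ⊑ ⟪ f ⟫
      0⊑⟪⟫ {f} 0⊑f = ⊑-trans (inj₂ (sym (⟪⟫-0 {λ _ → 0#} λ _ _ → refl))) (⟪⟫-mono {λ _ → 0#} {f} 0⊑f)

      0⊑X₁ : ∀ v χ → 0# ⊑ X₁ v χ
      0⊑X₁ v χ = ⊑-trans (inj₂ (sym (∑-0 V))) (∑-mono V λ u → 0⊑* (0⊑ind (v ~? u)) (0⊑ind (lookup χ u ≟ 1F)))

      0⊑N12 : ∀ v → 0# ⊑ N12 v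
      0⊑N12 v = 0⊑⟪⟫ λ χ → 0⊑* (0⊑X₁ v χ) (0⊑h₂ v χ)

      M≈z*W¬2 : ∀ v → M v ≈ z * W¬2 v
      M≈z*W¬2 v = trans (⟪⟫-cong λ χ → sym (*-identityʳ (coloured 1F v χ)))
        (trans (⟪coloured₁⟫ v {λ _ → 1#} λ _ _ → refl) (*-congˡ (⟪⟫-cong λ χ → *-congˡ (*-identityʳ (free 2F v χ)))))

      M-swap : ∀ v → ⟪ coloured 2F v ⟫ ≈ M v
      M-swap v = ⟪⟫-swap (coloured-swap 2F v)

      coloured-total : ∀ v χ → coloured 0F v χ + (coloured 1F v χ + coloured 2F v χ) ≈ 1#
      coloured-total v χ with lookup χ v
      ... | 0F = trans (+-congˡ (+-identityˡ 0#)) (+-identityʳ 1#)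
      ... | 1F = trans (+-identityˡ _) (+-identityʳ 1#)
      ... | 2F = trans (+-identityˡ _) (+-identityˡ 1#)

      -- The event is split by colour 2 among the neighbours and then by colour 1. The remaining
      -- part, 2 but not 1, has weight `W1¬2 v` by the colour symmetry.
      W-split : ∀ v → W v ≈ W¬2 v + (W1¬2 v + W12 v)
      W-split v = begin-equality
        W v
          ≈⟨ split (coloured 0F v) (λ χ → free? 2F v χ) ⟩
        ⟪ (λ χ → free 2F v χ * coloured 0F v χ) ⟫ + ⟪ (λ χ → blocked 2F v χ * coloured 0F v χ) ⟫
          ≈⟨ +-cong (⟪⟫-cong λ χ → *-comm (free 2F v χ) (coloured 0F v χ))
                    (⟪⟫-cong λ χ → *-comm (blocked 2F v χ) (coloured 0F v χ)) ⟩
        W¬2 v + ⟪ h₂ v ⟫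
          ≈⟨ +-congˡ (split (h₂ v) (λ χ → free? 1F v χ)) ⟩
        W¬2 v + (⟪ (λ χ → free 1F v χ * h₂ v χ) ⟫ + W12 v)
          ≈⟨ +-congˡ (+-congʳ (⟪⟫-swap λ χ → trans
               (*-cong (free-swap 1F v χ) (*-cong (coloured-swap 0F v χ) (blocked-swap χ)))
               (solve 3 (λ f c b → f :* (c :* b) := b :* (c :* f)) refl (free 2F v χ) (coloured 0F v χ) (blocked 1F v χ)))) ⟩
        W¬2 v + (W1¬2 v + W12 v) ∎
        where
        split : ∀ (f : Config → Carrier) {p} {P : Config → Set p} (P? : ∀ χ → Dec (P χ)) →
                ⟪ f ⟫ ≈ ⟪ (λ χ → ind (P? χ) * f χ) ⟫ + ⟪ (λ χ → ind (¬? (P? χ)) * f χ) ⟫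
        split f P? = trans
          (⟪⟫-cong λ χ → sym (trans (sym (distribʳ (f χ) _ _)) (trans (*-congʳ (ind-+-¬ (P? χ))) (*-identityˡ (f χ)))))
          (⟪⟫-+ (λ χ → ind (P? χ) * f χ) (λ χ → ind (¬? (P? χ)) * f χ))
        blocked-swap : ∀ χ → blocked 2F v (Vec.map swap χ) ≈ blocked 1F v χ
        blocked-swap χ = ind-cong (¬? (free? 2F v (Vec.map swap χ))) (¬? (free? 1F v χ))
          (λ ¬free free → ¬free λ b v~b → free b v~b ∘ lookup-swap χ b)
          (λ ¬free free → ¬free λ b v~b → free b v~b ∘ lookup-swap⁻¹ χ b)

      U : Vertex → Carrier
      U v = ∑ V (λ u → ind (v ~? u) * M u)

      -- Split by the colour of `v`: colour 2 excludes neighbours coloured 1, and colour 1 reduces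
      -- to colour 0 with no neighbour coloured 2, at the cost of a factor `z`.
      U-split : ∀ v → U v ≈ N1¬2 v + N12 v + z * N1¬2 v
      U-split v = begin-equality
        U v
          ≈⟨ ∑-cong V (λ u → *-congˡ (⟪⟫-cong λ χ → *-identityʳ (coloured 1F u χ))) ⟨
        ∑ V (λ u → ind (v ~? u) * ⟪ (λ χ → coloured 1F u χ * 1#) ⟫)
          ≈⟨ ⟪∑neighbours⟫ v (coloured 1F) (λ _ → 1#) ⟨
        ⟪ (λ χ → X₁ v χ * 1#) ⟫
          ≈⟨ ⟪⟫-cong (λ χ → trans (*-congˡ (sym (coloured-total v χ)))
               (solve 4 (λ x a b c → x :* (a :+ (b :+ c)) := a :* x :+ (b :* x :+ c :* x)) refl (X₁ v χ) _ _ _)) ⟩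
        ⟪ (λ χ → coloured 0F v χ * X₁ v χ + (coloured 1F v χ * X₁ v χ + coloured 2F v χ * X₁ v χ)) ⟫
          ≈⟨ trans (⟪⟫-+ (cX 0F) (λ χ → cX 1F χ + cX 2F χ)) (+-congˡ (⟪⟫-+ (cX 1F) (cX 2F))) ⟩
        ⟪ cX 0F ⟫ + (⟪ cX 1F ⟫ + ⟪ cX 2F ⟫)
          ≈⟨ +-cong c₀ (+-cong c₁ (⟪⟫-0 c₂)) ⟩
        (N1¬2 v + N12 v) + (z * N1¬2 v + 0#)
          ≈⟨ +-congˡ (+-identityʳ _) ⟩
        N1¬2 v + N12 v + z * N1¬2 v ∎
        where
        cX : Fin 3 → Config → Carrier
        cX i χ = coloured i v χ * X₁ v χ
        c₀ : ⟪ cX 0F ⟫ ≈ N1¬2 v + N12 v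
        c₀ = trans (⟪⟫-cong λ χ → trans (trans (sym (*-identityʳ _)) (*-congˡ (sym (ind-+-¬ (free? 2F v χ)))))
            (solve 4 (λ a x f b → a :* x :* (f :+ b) := x :* (a :* f) :+ x :* (a :* b)) refl (coloured 0F v χ) (X₁ v χ) _ _))
          (⟪⟫-+ (λ χ → X₁ v χ * h₁ v χ) (λ χ → X₁ v χ * h₂ v χ))
        c₁ : ⟪ cX 1F ⟫ ≈ z * N1¬2 v
        c₁ = trans (⟪coloured₁⟫ v (X₁-invariant v)) (*-congˡ (⟪⟫-cong λ χ →
          solve 3 (λ a f x → a :* (f :* x) := x :* (a :* f)) refl (coloured 0F v χ) (free 2F v χ) (X₁ v χ)))
        c₂ : ∀ χ → IsWidomRowlinson G χ → cX 2F χ ≈ 0#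
        c₂ χ wr = trans (ind-*-cong (lookup χ v ≟ 2F) (λ χv≡2 → trans (∑-cong V λ u → trans
          (ind-*-cong (v ~? u) (λ v~u → ind-no (lookup χ u ≟ 1F) λ χu≡1 → wr u v (~-sym v~u) (χu≡1 , χv≡2)))
          (zeroʳ _)) (∑-0 V))) (zeroʳ _)

      -- In this combination `N1¬2 v` acquires the factor 1 + z = y that the local bound requires,
      -- and the leading term is the one that also occurs in `qzW`.
      qM+sU : ∀ v → q * M v + s * U v ≈ q * z * W¬2 v + (s * (y * N1¬2 v) + s * N12 v)
      qM+sU v = trans (+-cong (*-congˡ (M≈z*W¬2 v)) (*-congˡ (U-split v)))
        (solve 6 (λ q z a s b e → q :* (z :* a) :+ s :* (b :+ e :+ z :* b)
                               := q :* z :* a :+ (s :* ((con 1 :+ z) :* b) :+ s :* e)) refl q z (W¬2 v) s (N1¬2 v) (N12 v))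

      qzW : ∀ v → q * z * W v ≈ q * z * W¬2 v + (q * z * W1¬2 v + q * z * W12 v)
      qzW v = trans (*-congˡ (W-split v)) (trans (distribˡ _ _ _) (+-congˡ (distribˡ _ _ _)))

      -- `N12 v` enters `qM+sU` without the factor `y` that the local bound would allow; this slack
      -- is the source of strictness.
      N12-grow : ∀ v → s * N12 v ⊑ s * (y * N12 v)
      N12-grow v = *-monoʳ-⊑ (0⊑slope d) (⊑-trans (inj₂ (sym (*-identityˡ _))) (*-monoˡ-⊑ (0⊑N12 v) 1⊑y))

      N1¬2-bound : ∀ v → s * (y * N1¬2 v) ⊑ q * z * W1¬2 v
      N1¬2-bound v = local-⊑ v (h₁-invariant v) d (regular v) (0⊑h₁ v)

      N12-bound : ∀ v → s * (y * N12 v) ⊑ q * z * W12 v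
      N12-bound v = local-⊑ v (h₂-invariant v) d (regular v) (0⊑h₂ v)

      vertex-⊑ : ∀ v → q * M v + s * U v ⊑ q * z * W v
      vertex-⊑ v = begin
        q * M v + s * U v                                    ≈⟨ qM+sU v ⟩
        q * z * W¬2 v + (s * (y * N1¬2 v) + s * N12 v)       ≤⟨ +-monoʳ-⊑ _ (+-mono-⊑ (N1¬2-bound v) (⊑-trans (N12-grow v) (N12-bound v))) ⟩
        q * z * W¬2 v + (q * z * W1¬2 v + q * z * W12 v)     ≈⟨ qzW v ⟨
        q * z * W v                                          ∎

      -- Since y > 1, the bound on y * (s * N12 v) leaves s * N12 v strictly below `t` as soon as
      -- `t` is positive.
      vertex-< : ∀ v → 0# < W12 v → q * M v + s * U v < q * z * W v
      vertex-< v 0<W12 = begin-strict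
        q * M v + s * U v                                    ≈⟨ qM+sU v ⟩
        q * z * W¬2 v + (s * (y * N1¬2 v) + s * N12 v)       <⟨ +-monoʳ-< _ (+-mono-⊑-< (N1¬2-bound v) s*N12<t) ⟩
        q * z * W¬2 v + (q * z * W1¬2 v + q * z * W12 v)     ≈⟨ qzW v ⟨
        q * z * W v                                          ∎
        where
        t = q * z * W12 v
        0<t : 0# < t
        0<t = *-pos (*-pos 0<q 0<z) 0<W12
        s*N12<t : s * N12 v < t
        s*N12<t = *-cancelˡ-< 0<y (begin-strict
          y * (s * N12 v)  ≈⟨ x*yz≈y*xz y s (N12 v) ⟩
          s * (y * N12 v)  ≤⟨ N12-bound v ⟩
          t                ≈⟨ +-identityʳ t ⟨
          t + 0#           <⟨ +-monoʳ-< t (*-pos 0<z 0<t) ⟩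
          t + z * t        ≈⟨ solve 2 (λ t z → t :+ z :* t := (con 1 :+ z) :* t) refl t z ⟩
          y * t            ∎)

      -- Non-adjacent neighbours make both colours appear.

      module _ {u u′ v} (v~u : v ~ u) (v~u′ : v ~ u′) (u≢u′ : u ≢ u′) (u≁u′ : ¬ u ~ u′) where

        private
          χ : Config
          χ = (Vec.replicate order 0F [ u ]≔ 1F) [ u′ ]≔ 2F

          χu≡1 : lookup χ u ≡ 1F
          χu≡1 = ≡.trans (Vecₚ.lookup∘update′ u≢u′ (Vec.replicate order 0F [ u ]≔ 1F) 2F) (Vecₚ.lookup∘update u (Vec.replicate order 0F) 1F)

          χu′≡2 : lookup χ u′ ≡ 2F
          χu′≡2 = Vecₚ.lookup∘update u′ (Vec.replicate order 0F [ u ]≔ 1F) 2F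

          χ≡0 : ∀ x → x ≢ u → x ≢ u′ → lookup χ x ≡ 0F
          χ≡0 x x≢u x≢u′ = ≡.trans (Vecₚ.lookup∘update′ x≢u′ (Vec.replicate order 0F [ u ]≔ 1F) 2F)
            (≡.trans (Vecₚ.lookup∘update′ x≢u (Vec.replicate order 0F) 1F) (Vecₚ.lookup-replicate x 0F))

          χ≡1⇒ : ∀ x → lookup χ x ≡ 1F → x ≡ u
          χ≡1⇒ x χx≡1 with x ≟ u | x ≟ u′
          ... | yes x≡u | _          = x≡u
          ... | no _    | yes ≡.refl with () ← ≡.trans (≡.sym χu′≡2) χx≡1
          ... | no x≢u  | no x≢u′    with () ← ≡.trans (≡.sym (χ≡0 x x≢u x≢u′)) χx≡1

          χ≡2⇒ : ∀ x → lookup χ x ≡ 2F → x ≡ u′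
          χ≡2⇒ x χx≡2 with x ≟ u | x ≟ u′
          ... | _          | yes x≡u′ = x≡u′
          ... | yes ≡.refl | no _     with () ← ≡.trans (≡.sym χu≡1) χx≡2
          ... | no x≢u     | no x≢u′  with () ← ≡.trans (≡.sym (χ≡0 x x≢u x≢u′)) χx≡2

          χ-WR : IsWidomRowlinson G χ
          χ-WR a b a~b (χa≡1 , χb≡2) = u≁u′ (≡.subst₂ _~_ (χ≡1⇒ a χa≡1) (χ≡2⇒ b χb≡2) a~b)

        -- The colouring `χ` has 1 at `u`, 2 at `u′` and 0 elsewhere. Its only possible conflict
        -- would be an edge between `u` and `u′`, so it is valid, and it contributes a positive
        -- summand to a sum of nonnegative ones.
        0<W12 : 0# < W12 v
        0<W12 = 0<∑ (∈-colourings χ)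
          (λ χ → 0⊑* (0⊑w χ) (0⊑* (0⊑ind (¬? (free? 1F v χ))) (0⊑h₂ v χ)))
          (*-pos (*-pos (0<ind (isWR? χ) χ-WR) (^-pos (X 1F χ ℕ.+ X 2F χ) 0<z))
            (*-pos (0<ind (¬? (free? 1F v χ)) λ free → free u v~u χu≡1)
              (*-pos (0<ind (lookup χ v ≟ 0F) (χ≡0 v (~⇒≢ v~u) (~⇒≢ v~u′)))
                (0<ind (¬? (free? 2F v χ)) λ free → free u′ v~u′ χu′≡2))))

      -- Pairwise adjacent neighbours cannot carry both colours, so `N12 v` and `W12 v` vanish; and
      -- where `h₁ v` is nonzero all neighbours are available, so the local bound is an equality.
      vertex-≈ : Clustered G → ∀ v → q * M v + s * U v ≈ q * z * W v
      vertex-≈ clustered v = begin-equality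
        q * M v + s * U v                                    ≈⟨ qM+sU v ⟩
        q * z * W¬2 v + (s * (y * N1¬2 v) + s * N12 v)       ≈⟨ +-congˡ (+-cong (local-≈ v (h₁-invariant v) d full) N12-vanishes) ⟩
        q * z * W¬2 v + (q * z * W1¬2 v + q * z * W12 v)     ≈⟨ qzW v ⟨
        q * z * W v                                          ∎
        where
        not-both : ∀ χ → IsWidomRowlinson G χ → ∀ {u} → v ~ u → lookup χ u ≡ 1F → h₂ v χ ≈ 0#
        not-both χ wr {u} v~u χu≡1 = trans (*-congˡ (ind-no (¬? (free? 2F v χ)) λ ¬free → ¬free λ x v~x χx≡2 →
          wr u x (clustered v~u v~x (λ { ≡.refl → case ≡.trans (≡.sym χu≡1) χx≡2 of λ () })) (χu≡1 , χx≡2))) (zeroʳ _)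
        N12≈0 : N12 v ≈ 0#
        N12≈0 = ⟪⟫-0 λ χ wr → trans (∑-* (h₂ v χ) V) (trans (∑-cong V λ u → trans (*-assoc _ _ _) (trans
          (ind-*-cong (v ~? u) (λ v~u → trans (ind-*-cong (lookup χ u ≟ 1F) (not-both χ wr v~u)) (zeroʳ _)))
          (zeroʳ _))) (∑-0 V))
        W12≈0 : W12 v ≈ 0#
        W12≈0 = ⟪⟫-0 λ χ wr → case free? 1F v χ of λ where
          (yes free) → trans (*-congʳ (ind-no (¬? (free? 1F v χ)) λ ¬free → ¬free free)) (zeroˡ _)
          -- A search through the finitely many vertices finds a neighbour coloured 1; decidability
          -- turns the negated implication into these two facts.
          (no ¬free) → case Finₚ.¬∀⟶∃¬ order _ (λ x → (v ~? x) →-dec ¬? (lookup χ x ≟ 1F)) ¬free of λ where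
            (u , ¬imp) → trans (*-congˡ (not-both χ wr (decidable-stable (v ~? u) λ v≁u → ¬imp λ v~u → ⊥-elim (v≁u v~u))
                                  (decidable-stable (lookup χ u ≟ 1F) λ χu≢1 → ¬imp λ _ → χu≢1))) (zeroʳ _)
        N12-vanishes : s * N12 v ≈ q * z * W12 v
        N12-vanishes = trans (trans (*-congˡ N12≈0) (zeroʳ s)) (sym (trans (*-congˡ W12≈0) (zeroʳ _)))
        full : ∀ χ → IsWidomRowlinson G χ → h₁ v χ ≈ 0# ⊎ #availableNbrs v χ ≡ d
        full χ wr with lookup χ v ≟ 0F | free? 2F v χ
        ... | no χv≢0  | _        = inj₁ (zeroˡ _)
        ... | yes _    | no ¬free = inj₁ (trans (*-congˡ (ind-no (free? 2F v χ) ¬free)) (zeroʳ _))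
        ... | yes χv≡0 | yes free = inj₂ (≡.trans
          (≡.cong length (Listₚ.filter-all (λ u → available? u χ) (All.tabulate λ {u} u∈ →
            let v~u = ∈-neighbours⁻ u∈ in free u v~u , free′ u v~u)))
          (≡.trans (length-neighbours v) (regular v)))
          where
          free′ : ∀ u → v ~ u → Free 2F u χ
          -- A neighbour of `u` is either `v`, which has colour 0, or by clustering another
          -- neighbour of `v`, which does not have colour 2.
          free′ u v~u x u~x χx≡2 with v ≟ x
          ... | yes ≡.refl = case ≡.trans (≡.sym χv≡0) χx≡2 of λ ()
          ... | no v≢x     = free x (clustered (~-sym v~u) u~x v≢x) χx≡2

      -- The occupancy fraction of K (suc d) is numerator / denominator = 2qz / (2q - 1 + 2qz).
      denominator numerator Total N Z α : Carrier
      denominator = q + pow-1 d + (q * z + q * z)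
      numerator   = q * z + q * z
      Total       = ∑ V M
      N           = fromℕ order
      Z           = WR.partition G z
      α           = WR.occupancyFraction G z 0<z

      0<N : 0# < N
      0<N = fromℕ-pos order

      0<Z : 0# < Z
      0<Z = WR.partition-pos G z 0<z

      0<denominator : 0# < denominator
      0<denominator = begin-strict
        0#                           <⟨ *-pos 0<q 0<z ⟩
        q * z                        ≤⟨ x⊑x+y (q * z) (inj₁ (*-pos 0<q 0<z)) ⟩
        q * z + q * z                ≤⟨ x⊑y+x _ (0⊑+ (inj₁ 0<q) (0⊑pow-1 d)) ⟩
        denominator                  ∎

      -- Summation over the vertices and the occupancy fraction.

      Z≈⟪1⟫ : Z ≈ ⟪ (λ _ → 1#) ⟫
      Z≈⟪1⟫ = trans (∑-filter (isWidomRowlinson? G) (colourings order))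
        (∑-cong (colourings order) λ χ → sym (*-identityʳ (w χ)))

      W+M+M≈Z : ∀ v → W v + (M v + M v) ≈ Z
      W+M+M≈Z v = begin-equality
        W v + (M v + M v)                      ≈⟨ +-congˡ (+-congˡ (M-swap v)) ⟨
        W v + (M v + ⟪ coloured 2F v ⟫)        ≈⟨ trans (⟪⟫-+ (coloured 0F v) (λ χ → coloured 1F v χ + coloured 2F v χ))
                                                    (+-congˡ (⟪⟫-+ (coloured 1F v) (coloured 2F v))) ⟨
        ⟪ (λ χ → coloured 0F v χ + (coloured 1F v χ + coloured 2F v χ)) ⟫  ≈⟨ ⟪⟫-cong (coloured-total v) ⟩
        ⟪ (λ _ → 1#) ⟫                         ≈⟨ Z≈⟪1⟫ ⟨
        Z                                      ∎

      ∑-neighbours : ∀ u → ∑ V (λ v → ind (v ~? u)) ≈ fromℕ d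
      ∑-neighbours u = begin-equality
        ∑ V (λ v → ind (v ~? u))     ≈⟨ ∑-cong V (λ v → ind-cong (v ~? u) (u ~? v) ~-sym ~-sym) ⟩
        ∑ V (λ v → ind (u ~? v))     ≈⟨ fromℕ-length-filter (u ~?_) V ⟨
        fromℕ (length (neighbours u))  ≡⟨ ≡.cong fromℕ (≡.trans (length-neighbours u) (regular u)) ⟩
        fromℕ d                      ∎

      -- Double counting: every `u` is counted once for each of its `d` neighbours.
      ∑U≈d*Total : ∑ V U ≈ fromℕ d * Total
      ∑U≈d*Total = begin-equality
        ∑ V (λ v → ∑ V (λ u → ind (v ~? u) * M u))   ≈⟨ ∑-comm V V ⟩
        ∑ V (λ u → ∑ V (λ v → ind (v ~? u) * M u))   ≈⟨ ∑-cong V (λ u → ∑-* (M u) V) ⟨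
        ∑ V (λ u → ∑ V (λ v → ind (v ~? u)) * M u)   ≈⟨ ∑-cong V (λ u → *-congʳ (∑-neighbours u)) ⟩
        ∑ V (λ u → fromℕ d * M u)                    ≈⟨ *-∑ (fromℕ d) V ⟨
        fromℕ d * Total                              ∎

      -- The sides of the vertex inequality, with a common term added that completes `W v` to the
      -- partition function and so makes the right side independent of `v`.
      lhs rhs : Vertex → Carrier
      lhs v = q * M v + s * U v + q * z * (M v + M v)
      rhs v = q * z * W v + q * z * (M v + M v)

      ∑lhs : ∑ V lhs ≈ denominator * Total
      ∑lhs = begin-equality
        ∑ V lhs
          ≈⟨ trans (∑-+ V) (+-cong (trans (∑-+ V) (+-cong (sym (*-∑ q V)) (sym (*-∑ s V))))
               (trans (sym (*-∑ (q * z) V)) (*-congˡ (∑-+ V)))) ⟩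
        q * Total + s * ∑ V U + q * z * (Total + Total)
          ≈⟨ +-congʳ (+-congˡ (trans (*-congˡ ∑U≈d*Total) (trans (sym (*-assoc s (fromℕ d) Total))
               (*-congʳ (trans (*-comm s (fromℕ d)) (fromℕ*slope d)))))) ⟩
        q * Total + pow-1 d * Total + q * z * (Total + Total)
          ≈⟨ solve 4 (λ q p z t → q :* t :+ p :* t :+ q :* z :* (t :+ t) := (q :+ p :+ (q :* z :+ q :* z)) :* t)
               refl q (pow-1 d) z Total ⟩
        denominator * Total ∎

      ∑rhs : ∑ V rhs ≈ N * (q * z * Z)
      ∑rhs = begin-equality
        ∑ V rhs                          ≈⟨ ∑-cong V (λ v → trans (sym (distribˡ (q * z) (W v) (M v + M v))) (*-congˡ (W+M+M≈Z v))) ⟩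
        ∑ V (λ _ → q * z * Z)            ≈⟨ ∑-cong V (λ _ → *-identityˡ _) ⟨
        ∑ V (λ _ → 1# * (q * z * Z))     ≈⟨ ∑-* (q * z * Z) V ⟨
        ∑ V (λ _ → 1#) * (q * z * Z)     ≈⟨ *-congʳ (∑-1 order) ⟩
        N * (q * z * Z)                  ∎

      -- By linearity the expected number of coloured vertices is a sum over vertices, in which
      -- colours 1 and 2 contribute equally by symmetry.
      α≈ : α ≈ recip Z 0<Z * recip N 0<N * (Total + Total)
      α≈ = begin-equality
        ∑ (Ω G) (λ χ → WR.weight G z χ * recip Z 0<Z * fromℕ (X 1F χ ℕ.+ X 2F χ)) * recip N 0<N
          ≈⟨ *-congʳ (∑-filter (isWidomRowlinson? G) (colourings order)) ⟩
        ∑ (colourings order) (λ χ → ind (isWR? χ) * (WR.weight G z χ * recip Z 0<Z * fromℕ (X 1F χ ℕ.+ X 2F χ))) * recip N 0<N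
          ≈⟨ *-congʳ (∑-cong (colourings order) λ χ →
               solve 4 (λ i w r x → i :* (w :* r :* x) := r :* (i :* w :* x)) refl (ind (isWR? χ)) (WR.weight G z χ) (recip Z 0<Z) _) ⟩
        ∑ (colourings order) (λ χ → recip Z 0<Z * (w χ * fromℕ (X 1F χ ℕ.+ X 2F χ))) * recip N 0<N
          ≈⟨ *-congʳ (*-∑ (recip Z 0<Z) (colourings order)) ⟨
        recip Z 0<Z * ⟪ (λ χ → fromℕ (X 1F χ ℕ.+ X 2F χ)) ⟫ * recip N 0<N
          ≈⟨ solve 3 (λ a b c → a :* b :* c := a :* c :* b) refl (recip Z 0<Z) _ (recip N 0<N) ⟩
        recip Z 0<Z * recip N 0<N * ⟪ (λ χ → fromℕ (X 1F χ ℕ.+ X 2F χ)) ⟫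
          ≈⟨ *-congˡ (⟪⟫-cong λ χ → trans (×-homo-+ 1# (X 1F χ) (X 2F χ)) (+-cong (fromℕ-X 1F χ) (fromℕ-X 2F χ))) ⟩
        recip Z 0<Z * recip N 0<N * ⟪ (λ χ → ∑ V (λ v → coloured 1F v χ) + ∑ V (λ v → coloured 2F v χ)) ⟫
          ≈⟨ *-congˡ (trans (⟪⟫-+ (λ χ → ∑ V (λ v → coloured 1F v χ)) (λ χ → ∑ V (λ v → coloured 2F v χ)))
               (+-cong (⟪⟫-∑ V (coloured 1F)) (trans (⟪⟫-∑ V (coloured 2F)) (∑-cong V M-swap)))) ⟩
        recip Z 0<Z * recip N 0<N * (Total + Total) ∎

      -- The normalisation 2 / (Z N), for which `k * Total` is the occupancy fraction.
      k : Carrier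
      k = recip Z 0<Z * recip N 0<N * (1# + 1#)

      0<k : 0# < k
      0<k = *-pos (*-pos (recip-pos Z 0<Z) (recip-pos N 0<N)) (+-pos 0<1 0<1)

      k*∑lhs : k * ∑ V lhs ≈ denominator * α
      k*∑lhs = begin-equality
        k * ∑ V lhs                ≈⟨ *-congˡ ∑lhs ⟩
        k * (denominator * Total)  ≈⟨ solve 3 (λ r d t → r :* (con 1 :+ con 1) :* (d :* t) := d :* (r :* (t :+ t)))
                                        refl (recip Z 0<Z * recip N 0<N) denominator Total ⟩
        denominator * (recip Z 0<Z * recip N 0<N * (Total + Total))  ≈⟨ *-congˡ α≈ ⟨
        denominator * α            ∎

      k*∑rhs : k * ∑ V rhs ≈ numerator
      k*∑rhs = begin-equality
        k * ∑ V rhs             ≈⟨ *-congˡ ∑rhs ⟩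
        k * (N * (q * z * Z))   ≈⟨ solve 5 (λ r s n t z → r :* s :* (con 1 :+ con 1) :* (n :* (t :* z)) := (r :* z) :* ((s :* n) :* (t :+ t)))
                                     refl (recip Z 0<Z) (recip N 0<N) N (q * z) Z ⟩
        recip Z 0<Z * Z * (recip N 0<N * N * numerator)
          ≈⟨ trans (*-congʳ (recip-inverseˡ Z 0<Z)) (trans (*-identityˡ _) (trans (*-congʳ (recip-inverseˡ N 0<N)) (*-identityˡ _))) ⟩
        numerator ∎

      α-⊑ : denominator * α ⊑ numerator
      α-⊑ = begin
        denominator * α  ≈⟨ k*∑lhs ⟨
        k * ∑ V lhs      ≤⟨ *-monoʳ-⊑ (inj₁ 0<k) (∑-mono V λ v → +-monoˡ-⊑ _ (vertex-⊑ v)) ⟩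
        k * ∑ V rhs      ≈⟨ k*∑rhs ⟩
        numerator        ∎

      α-< : ∀ {v u u′} → v ~ u → v ~ u′ → u ≢ u′ → ¬ u ~ u′ → denominator * α < numerator
      α-< {v} v~u v~u′ u≢u′ u≁u′ = begin-strict
        denominator * α  ≈⟨ k*∑lhs ⟨
        k * ∑ V lhs      <⟨ *-monoʳ-< 0<k (∑-mono-< (∈-allFin v) (λ v → +-monoˡ-⊑ _ (vertex-⊑ v))
                              (+-monoˡ-< _ (vertex-< v (0<W12 v~u v~u′ u≢u′ u≁u′)))) ⟩
        k * ∑ V rhs      ≈⟨ k*∑rhs ⟩
        numerator        ∎

      α-≈ : Clustered G → denominator * α ≈ numerator
      α-≈ clustered = trans (sym k*∑lhs)
        (trans (*-congˡ (∑-cong V λ v → +-congʳ (vertex-≈ clustered v))) k*∑rhs)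

-- Comparison with the complete graph.

theorem1 : ∀ {c ℓ₁ ℓ₂ ℓ₃} (F : OrderedField c ℓ₁ ℓ₂ ℓ₃) →
    let open OrderedField F
        open WidomRowlinson F renaming (occupancyFraction to α)
    in (d : ℕ) (G : Graph) → Regular d G →
       (z : Carrier) (0<z : 0# < z) →
       (α G z 0<z ≤ α (K (suc d)) z 0<z)
       × ((α G z 0<z ≈ α (K (suc d)) z 0<z) ⇔ IsDisjointUnionOfCopiesOf (K (suc d)) G)
theorem1 F d G regular z 0<z =
  ⊑⇒≤ (*-cancelˡ-⊑ 𝔾.0<denominator (⊑-trans 𝔾.α-⊑ (inj₂ (sym αK)))) ,
  -- Two distinct non-adjacent neighbours of a vertex would make the bound strict, contrary to
  -- equality; decidability of adjacency then gives the edge.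
  mk⇔ (λ αG≈αK → clustered⇒disjointUnion G regular
         (λ {v} {u} {u′} v~u v~u′ u≢u′ → decidable-stable (u ~? u′)
           λ u≁u′ → <-irrefl (trans (*-congˡ αG≈αK) αK) (𝔾.α-< v~u v~u′ u≢u′ u≁u′)))
      (λ union → *-cancelˡ 𝔾.0<denominator (trans (𝔾.α-≈ (disjointUnion⇒clustered union)) (sym αK)))
  where
  open OccupancyBound F
  open Graph G using (_~?_)
  module 𝔾 = Model.RegularModel G z 0<z d regular
  module 𝕂 = Model.RegularModel (K (suc d)) z 0<z d (K-regular d)
  αK : 𝔾.denominator * 𝕂.α ≈ 𝔾.numerator
  -- The numerator and denominator involve only `z` and `d`, so those of the two graphs agree by
  -- definition.
  αK = 𝕂.α-≈ (K-clustered d)
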